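{- There is a static data structure (called esp) which, for every ordered set $S\subset\{0,1,\ldots,n-1\}$, stores a representation of $S$ in $nH_0(S)+o(n)$ bits in the worst case, and which, on the word RAM, answers each query $\mathrm{rank}(x,S)$ in $O(1)$ worst-case time and each query $\mathrm{select}(i,S)$ in $O(1)$ worst-case time.
   Context: For $S\subset\{0,1,\ldots,n-1\}$ with $m$ elements: $\mathrm{rank}(x,S)$ is the number of elements of $S$ which are no greater than $x$, and $\mathrm{select}(i,S)$ is the $i$-th smallest element of $S$. The zero-th order empirical entropy $H_0(S)\le 1$ is defined by $nH_0(S)=m\log_2\frac{n}{m}+(n-m)\log_2\frac{n}{n-m}$ (with the usual convention that a term with coefficient $0$ equals $0$). Word RAM model: logical and arithmetic operations on two $O(\log n)$-bit integers take constant time, and any consecutive $O(\log n)$ bits of memory at any address can be read or written in constant time. The term $o(n)$ is as $n\to\infty$. -}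

module Defs where

open import Data.Bool using (Bool; true; false; not; if_then_else_; _∧_; _∨_; _xor_)
open import Data.Fin using (Fin; zero; toℕ)
open import Data.Fin.Properties using (_≤?_)
open import Data.Fin.Subset using (Subset; ∣_∣)
open import Data.Fin.Subset.Properties using (_∈?_)
open import Data.Integer using (+_; -[1+_])
open import Data.List as List using (List; length; filter; allFin)
open import Data.Nat using (ℕ; zero; suc; _+_; _*_; _∸_; _^_; _/_; _%_; _⊓_; _≤_; _≥_; _<_; _≡ᵇ_; _<ᵇ_; _≤ᵇ_)
open import Data.Nat.Logarithm using (⌊log₂_⌋)
open import Data.Product using (_×_; _,_; ∃-syntax)
open import Data.Rational.Unnormalised as ℚ using (ℚᵘ; mkℚᵘ)
open import Data.Vec as Vec using (Vec; []; _∷_; lookup; tabulate; replicate; zipWith; _[_]≔_)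
open import Relation.Binary.PropositionalEquality using (_≡_)

-- The elements of S in increasing order.
elements : ∀ {n} → Subset n → List (Fin n)
elements S = filter (_∈? S) (allFin _)

rank : ∀ {n} → Fin n → Subset n → ℕ
rank x S = length (filter (_≤? x) (elements S))

-- Here i counts from 0, so select i S is the (1 + toℕ i)-th smallest element.
select : ∀ {n} (S : Subset n) → Fin (length (elements S)) → Fin n
select S = List.lookup (elements S)

-- A real number is given by its lower Dedekind cut, the set of rationals
-- strictly below it.  Inclusion of cuts is the order.
LowerReal : Set₁
LowerReal = ℚᵘ → Set

infix  4 _≤ᴿ_
infixl 6 _+ᴿ_
infixl 7 _·ᴿ_

_≤ᴿ_ : LowerReal → LowerReal → Set
X ≤ᴿ Y = ∀ q → X q → Y q

fromℕᴿ : ℕ → LowerReal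
fromℕᴿ k q = q ℚ.< mkℚᵘ (+ k) 0

_+ᴿ_ : LowerReal → LowerReal → LowerReal
(X +ᴿ Y) q = ∃[ x ] ∃[ y ] (X x × Y y × q ℚ.< x ℚ.+ y)

-- The zero clause is the convention that a term with coefficient 0 is 0,
-- whatever the other factor (below it may be log₂ (n / 0)).
_·ᴿ_ : ℕ → LowerReal → LowerReal
zero  ·ᴿ X = fromℕᴿ 0
suc k ·ᴿ X = λ q → ∃[ x ] (X x × q ℚ.< mkℚᵘ (+ suc k) 0 ℚ.* x)

-- log₂ (a / b) for positive a and b:  s / d < log₂ (a / b)  iff
-- 2 ^ s < (a / b) ^ d,  with denominators cleared.
log₂[_/_] : ℕ → ℕ → LowerReal
log₂[ a / b ] (mkℚᵘ (+ s)    d-1) = 2 ^ s * b ^ suc d-1 < a ^ suc d-1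
log₂[ a / b ] (mkℚᵘ -[1+ s ] d-1) = b ^ suc d-1 < 2 ^ suc s * a ^ suc d-1

-- n H₀(S)
nH₀ : ∀ {n} → Subset n → LowerReal
nH₀ {n} S = m ·ᴿ log₂[ n / m ] +ᴿ (n ∸ m) ·ᴿ log₂[ n / n ∸ m ]
  where m = ∣ S ∣

LittleO[n] : (ℕ → ℕ) → Set
LittleO[n] r = ∀ k → ∃[ N ] (∀ n → n ≥ N → k * r n ≤ n)

-- Words have w bits, least significant first.
Word : ℕ → Set
Word w = Vec Bool w

value : ∀ {w} → Word w → ℕ
value []       = 0
value (b ∷ bs) = (if b then 1 else 0) + 2 * value bs

-- The w-bit word representing x modulo 2 ^ w.
word : ∀ w → ℕ → Word w
word zero    x = []
word (suc w) x = (x % 2 ≡ᵇ 1) ∷ word w (x / 2)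

data BinOp : Set where
  add sub mul div mod band bor bxor shl shr : BinOp

-- Arithmetic is modulo 2 ^ w; div and mod by zero return zero.
evalOp : ∀ {w} → BinOp → Word w → Word w → Word w
evalOp {w} add a b = word w (value a + value b)
evalOp {w} sub a b = word w ((value a + 2 ^ w) ∸ value b)
evalOp {w} mul a b = word w (value a * value b)
evalOp {w} div a b with value b
... | zero  = word w 0
... | suc v = word w (value a / suc v)
evalOp {w} mod a b with value b
... | zero  = word w 0
... | suc v = word w (value a % suc v)
evalOp     band a b = zipWith _∧_ a b
evalOp     bor  a b = zipWith _∨_ a b
evalOp     bxor a b = zipWith _xor_ a b
evalOp {w} shl a b = word w (value a * 2 ^ value b)
evalOp {w} shr a b with 2 ^ value b
... | zero  = word w 0  -- unreachable
... | suc v = word w (value a / suc v)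

-- Bit-addressed memory.
Memory : Set
Memory = ℕ → Bool

-- The min(ℓ, w) bits at addresses a, a + 1, …, zero-extended to a word.
readBits : ∀ {w} → Memory → (a ℓ : ℕ) → Word w
readBits μ a ℓ = tabulate λ j → (toℕ j <ᵇ ℓ) ∧ μ (a + toℕ j)

bit : ∀ {w} → Word w → ℕ → Bool
bit []       j       = false
bit (b ∷ bs) zero    = b
bit (b ∷ bs) (suc j) = bit bs j

-- Overwrites the min(ℓ, w) bits at addresses a, a + 1, … by the low bits of v.
writeBits : ∀ {w} → Memory → (a ℓ : ℕ) → Word w → Memory
writeBits {w} μ a ℓ v p =
  if (a ≤ᵇ p) ∧ (p <ᵇ a + (ℓ ⊓ w)) then bit v (p ∸ a) else μ p

-- Instructions of a word RAM with k registers; neither they nor programs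
-- mention the word length w, so one program serves all w.
data Instr (k : ℕ) : Set where
  const   : (dst : Fin k) → ℕ → Instr k
  wordLen : (dst : Fin k) → Instr k
  move    : (dst src : Fin k) → Instr k
  binop   : BinOp → (dst src₁ src₂ : Fin k) → Instr k
  bnot    : (dst src : Fin k) → Instr k
  load    : (dst addr len : Fin k) → Instr k
  store   : (src addr len : Fin k) → Instr k

data Test (k : ℕ) : Set where
  eq lt : Fin k → Fin k → Test k

infixr 5 _⨾_

data Program (k : ℕ) : Set where
  skip  : Program k
  instr : Instr k → Program k
  _⨾_   : Program k → Program k → Program k
  cond  : Test k → Program k → Program k → Program k
  while : Test k → Program k → Program k

State : ℕ → ℕ → Set
State w k = Vec (Word w) k × Memory

exec : ∀ {w k} → Instr k → State w k → State w k
exec {w} (const d c)     (ρ , μ) = ρ [ d ]≔ word w c , μ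
exec {w} (wordLen d)     (ρ , μ) = ρ [ d ]≔ word w w , μ
exec     (move d s)      (ρ , μ) = ρ [ d ]≔ lookup ρ s , μ
exec     (binop f d s t) (ρ , μ) = ρ [ d ]≔ evalOp f (lookup ρ s) (lookup ρ t) , μ
exec     (bnot d s)      (ρ , μ) = ρ [ d ]≔ Vec.map not (lookup ρ s) , μ
exec     (load d a ℓ)    (ρ , μ) =
  ρ [ d ]≔ readBits μ (value (lookup ρ a)) (value (lookup ρ ℓ)) , μ
exec     (store s a ℓ)   (ρ , μ) =
  ρ , writeBits μ (value (lookup ρ a)) (value (lookup ρ ℓ)) (lookup ρ s)

test : ∀ {w k} → Test k → State w k → Bool
test (eq i j) (ρ , μ) = value (lookup ρ i) ≡ᵇ value (lookup ρ j)
test (lt i j) (ρ , μ) = value (lookup ρ i) <ᵇ value (lookup ρ j)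

infix 4 _,_⇓[_]_

-- P , σ ⇓[ t ] σ′: started in σ, P halts in σ′ after t unit-cost steps; each
-- instruction and each evaluation of a test is one step.
data _,_⇓[_]_ {w k : ℕ} : Program k → State w k → ℕ → State w k → Set where
  ⇓skip  : ∀ {σ} → skip , σ ⇓[ 0 ] σ
  ⇓instr : ∀ {i σ} → instr i , σ ⇓[ 1 ] exec i σ
  ⇓seq   : ∀ {P Q σ σ′ σ″ t u} →
           P , σ ⇓[ t ] σ′ → Q , σ′ ⇓[ u ] σ″ → P ⨾ Q , σ ⇓[ t + u ] σ″
  ⇓then  : ∀ {b P Q σ σ′ t} → test b σ ≡ true →
           P , σ ⇓[ t ] σ′ → cond b P Q , σ ⇓[ suc t ] σ′
  ⇓else  : ∀ {b P Q σ σ′ t} → test b σ ≡ false →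
           Q , σ ⇓[ t ] σ′ → cond b P Q , σ ⇓[ suc t ] σ′
  ⇓loop  : ∀ {b P σ σ′ σ″ t u} → test b σ ≡ true →
           P , σ ⇓[ t ] σ′ → while b P , σ′ ⇓[ u ] σ″ →
           while b P , σ ⇓[ suc (t + u) ] σ″
  ⇓exit  : ∀ {b P σ} → test b σ ≡ false → while b P , σ ⇓[ 1 ] σ

-- The bits D occupy addresses 0, …, length D ∸ 1.
Stores : Memory → List Bool → Set
Stores μ D = ∀ j → μ (toℕ j) ≡ List.lookup D j

-- Run on the argument x in register 0, with the other registers zero, P leaves
-- y in register 0 within T steps.  Memory outside the representation D is
-- arbitrary, so a query can rely on D alone; P must leave D intact.
Answers : ∀ w {k} → Program (suc k) → (D : List Bool) (T x y : ℕ) → Set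
Answers w {k} P D T x y =
  ∀ (μ : Memory) → Stores μ D →
  ∃[ t ] ∃[ r ] ∃[ ρ ] ∃[ μ′ ]
    ( (P , (word w x ∷ replicate k (word w 0) , μ) ⇓[ t ] (r ∷ ρ , μ′))
    × t ≤ T × value r ≡ y × Stores μ′ D )

-- The fixed query programs do not depend on n; a program that needs n, or
-- lookup tables, must find them inside the encoding, where they count as space.
record StaticStructure : Set where
  field
    wordFactor    : ℕ
    extraRegs     : ℕ
    encode        : ∀ {n} → Subset n → List Bool
    rankProgram   : Program (suc extraRegs)
    selectProgram : Program (suc extraRegs)

  -- O(log n) bits: a constant multiple of the length of n in binary.
  wordLength : ℕ → ℕ
  wordLength n = wordFactor * suc ⌊log₂ n ⌋

open StaticStructure public

UsesSpace[nH₀+o[n]] : StaticStructure → Set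
UsesSpace[nH₀+o[n]] E =
  ∃[ r ] (LittleO[n] r ×
          (∀ n (S : Subset n) →
             fromℕᴿ (length (encode E S)) ≤ᴿ nH₀ S +ᴿ fromℕᴿ (r n)))

AnswersRankInO[1] : StaticStructure → Set
AnswersRankInO[1] E =
  ∃[ T ] (∀ n (S : Subset n) (x : Fin n) →
            Answers (wordLength E n) (rankProgram E) (encode E S) T
                    (toℕ x) (rank x S))

AnswersSelectInO[1] : StaticStructure → Set
AnswersSelectInO[1] E =
  ∃[ T ] (∀ n (S : Subset n) (i : Fin (length (elements S))) →
            Answers (wordLength E n) (selectProgram E) (encode E S) T
                    (suc (toℕ i)) (toℕ (select S i)))

{-# OPTIONS --safe #-}
module Submission where

-- The characteristic sequence of S is cut into blocks of b bits, b about
-- √log n.  A block is stored as its index among the words with as many ones.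
-- If m of the n bits are ones, give each one of a word the weight m and each
-- zero the weight n − m: the words of length b have total weight n ^ b, and
-- all words of one class have the same weight.  Multiplying over the blocks,
-- the product of the class sizes times m ^ m (n − m) ^ (n − m) is at most
-- n ^ n, so the codes take n H₀(S) bits, up to O(1) bits per block.  Tables
-- over all codes answer rank and select inside a block, and two-level
-- directories give the rank and the code position at each block boundary.
--
-- Select needs the block of the i-th one.  This is sampled at every K-th i.
-- Let k be the sampled block.  If the next block (or superblock) starts after
-- the i-th one, k is close enough; otherwise i lies in the group of K ones
-- that straddles the end of k, and for this group, which is determined by k,
-- all the answers are stored.  So the space is a multiple of K per block.
-- Applied with superblocks and then with blocks, this leaves only offsets of
-- O(log log n) bits at the lower level.

open import Defs
open import Data.Bool using (Bool; T; true; false; if_then_else_; _∧_; not)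
open import Data.Fin using (Fin; zero; suc; toℕ; fromℕ<)
open import Data.Fin.Properties using (toℕ<n; toℕ-fromℕ<; _≤?_) renaming (suc-injective to fsuc-injective)
open import Data.Fin.Subset using (Subset; ∣_∣)
open import Data.Fin.Subset.Properties using (_∈?_)
import Data.Integer as ℤ
import Data.Integer.Properties as ℤ
open import Data.List as List using (List; []; _∷_; _++_; length; filter; allFin)
open import Data.List.Membership.Propositional using (_∈_)
open import Data.List.Membership.Propositional.Properties using (∈-filter⁺; ∈-++⁺ˡ; ∈-++⁺ʳ; ∈-map⁺)
open import Data.List.Properties using (length-++; length-map; length-filter; filter-accept; filter-reject; map-++; map-∘; map-cong; map-tabulate)
open import Data.List.Relation.Unary.Any using (here; index)
open import Data.List.Relation.Unary.Any.Properties using (lookup-index)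
open import Data.Nat hiding (_≤?_)
open import Data.Nat.DivMod using (m%n<n; m%n≤m; m%n≤n; m/n≤m; m/n*n≤m; m*n/n≡m; m<n*o⇒m/o<n; m<n⇒m%n≡m; m<n⇒m/n≡0; m≥n⇒m/n>0; m≡m%n+[m/n]*n; [m+kn]%n≡m%n; +-distrib-/-∣ʳ; /-monoˡ-≤)
open import Data.Nat.Divisibility using (divides-refl)
open import Data.Nat.ListAction using (sum)
open import Data.Nat.ListAction.Properties using (sum-++)
open import Data.Nat.Logarithm using (⌊log₂_⌋; ⌊log₂⌋-mono-≤; ⌊log₂⌊n/2⌋⌋≡⌊log₂n⌋∸1; ⌊log₂[2^n]⌋≡n)
open import Data.Nat.Properties hiding (_≤?_)
open import Data.Nat.Tactic.RingSolver using (solve-∀)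
open import Data.Product using (Σ-syntax; _×_; _,_; ∃-syntax; proj₁; proj₂)
open import Data.Rational.Unnormalised as ℚ using (mkℚᵘ; *<*; *≤*; *≡*)
import Data.Rational.Unnormalised.Properties as ℚ
open import Data.Vec as Vec using (Vec; []; _∷_; lookup; tabulate; toList; replicate; _[_]≔_)
open import Data.Vec.Properties using (length-toList; lookup∘update; lookup∘update′)
open import Function using (_∘_)
open import Relation.Binary.PropositionalEquality
open import Relation.Nullary using (yes; no; does; contradiction)
open import Relation.Nullary.Decidable using (dec-true; dec-false)
open import Relation.Unary using (Decidable)

-- Partial sums and searches in monotone sequences

-- The programs know neither n nor S, so all parameters and section starts are words of a header.
-- Word arithmetic is modulo 2 ^ w, so every intermediate value needs a bound. Straight-line
-- expressions tame both issues: their syntax bounds the time, they never write to memory, and most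
-- bounds follow from the representation having fewer than 2 ^ w bits.
--
-- Select dictates the sizes. With L about log n and ℓ about log L, a superblock of Q blocks carries
-- K₁ answers of O(L) bits and a block carries K₂ answers of O(ℓ) bits, while the samples cost L /
-- K₁ and ℓ / K₂ bits per position. For b = u², Q = L², K₁ = L u and K₂ = u all of this is O(n ℓ /
-- u), which is o(n) when u is about L ^ (1/4). As b is then at most √L, the tables with their 2 ^ b
-- rows per class also stay within this bound.
--
-- Entropy is given as a cut, so no real logarithm is evaluated. The product inequality is raised to
-- a power d, logarithms are rounded to multiples of 1 / d, and d is large enough for all roundings
-- together to cost one bit.

sum< : (ℕ → ℕ) → ℕ → ℕ
sum< g zero    = 0
sum< g (suc i) = g 0 + sum< (g ∘ suc) i

sum<-suc : ∀ g i → sum< g (suc i) ≡ sum< g i + g i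
sum<-suc g zero    = +-comm (g 0) 0
sum<-suc g (suc i) = trans (cong (g 0 +_) (sum<-suc (g ∘ suc) i)) (sym (+-assoc (g 0) _ _))

sum<-+ : ∀ g a b → sum< g (a + b) ≡ sum< g a + sum< (λ j → g (a + j)) b
sum<-+ g zero    b = refl
sum<-+ g (suc a) b = trans (cong (g 0 +_) (sum<-+ (g ∘ suc) a b)) (sym (+-assoc (g 0) _ _))

sum<-cong : ∀ {g h} i → (∀ j → j < i → g j ≡ h j) → sum< g i ≡ sum< h i
sum<-cong zero    g≗h = refl
sum<-cong (suc i) g≗h = cong₂ _+_ (g≗h 0 z<s) (sum<-cong i λ j j<i → g≗h (suc j) (s<s j<i))

sum<-const : ∀ c i → sum< (λ _ → c) i ≡ i * c
sum<-const c zero    = refl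
sum<-const c (suc i) = cong (c +_) (sum<-const c i)

sum<-≤ : ∀ {g c} i → (∀ j → j < i → g j ≤ c) → sum< g i ≤ i * c
sum<-≤ zero    g≤c = z≤n
sum<-≤ (suc i) g≤c = +-mono-≤ (g≤c 0 z<s) (sum<-≤ i λ j j<i → g≤c (suc j) (s<s j<i))

sum<-mono-≤ : ∀ g {i j} → i ≤ j → sum< g i ≤ sum< g j
sum<-mono-≤ g z≤n       = z≤n
sum<-mono-≤ g (s≤s i≤j) = +-monoʳ-≤ (g 0) (sum<-mono-≤ (g ∘ suc) i≤j)

-- The least k with i < g (k + 1), provided that g 0 ≤ i < g N.
locate : (ℕ → ℕ) → ℕ → ℕ → ℕ
locate g zero    i = 0
locate g (suc N) i with i <? g 1
... | yes _ = 0
... | no  _ = suc (locate (g ∘ suc) N i)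

locate-correct : ∀ g N {i} → g 0 ≤ i → i < g N →
                 let k = locate g N i in k < N × g k ≤ i × i < g (suc k)
locate-correct g zero    lo hi = contradiction hi (≤⇒≯ lo)
locate-correct g (suc N) {i} lo hi with i <? g 1
... | yes i<g₁ = z<s , lo , i<g₁
... | no  i≮g₁ with locate-correct (g ∘ suc) N (≮⇒≥ i≮g₁) hi
...   | k<N , lo′ , hi′ = s<s k<N , lo′ , hi′

locate-≤ : ∀ g N i → locate g N i ≤ N
locate-≤ g zero    i = z≤n
locate-≤ g (suc N) i with i <? g 1
... | yes _ = z≤n
... | no  _ = s≤s (locate-≤ (g ∘ suc) N i)

module _ (g : ℕ → ℕ) (g-mono : ∀ {i j} → i ≤ j → g i ≤ g j) where

  bracket-mono : ∀ {i i′ k k′} → i ≤ i′ → g k ≤ i → i′ < g (suc k′) → k ≤ k′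
  bracket-mono i≤i′ lo hi = ≮⇒≥ λ k′<k →
    <⇒≱ (<-≤-trans hi (g-mono k′<k)) (≤-trans lo i≤i′)

  bracket-unique : ∀ {i k k′} → g k ≤ i → i < g (suc k) → g k′ ≤ i → i < g (suc k′) → k ≡ k′
  bracket-unique lo hi lo′ hi′ =
    ≤-antisym (bracket-mono ≤-refl lo hi′) (bracket-mono ≤-refl lo′ hi)

-- Words

n<2^n : ∀ n → n < 2 ^ n
n<2^n zero    = z<s
n<2^n (suc n) = <-≤-trans (s<s (n<2^n n))
  (+-mono-≤ (m^n>0 2 n) (≤-reflexive (sym (+-identityʳ (2 ^ n)))))

value-word : ∀ w {x} → x < 2 ^ w → value (word w x) ≡ x
value-word zero    x<1 = sym (n<1⇒n≡0 x<1)
value-word (suc w) {x} x<2^w = begin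
  (if x % 2 ≡ᵇ 1 then 1 else 0) + 2 * value (word w (x / 2))
    ≡⟨ cong₂ (λ c y → c + 2 * y) (bit₀ (x % 2) (m%n<n x 2)) (value-word w half) ⟩
  x % 2 + 2 * (x / 2)  ≡⟨ cong (x % 2 +_) (*-comm 2 (x / 2)) ⟩
  x % 2 + x / 2 * 2    ≡⟨ m≡m%n+[m/n]*n x 2 ⟨
  x                    ∎
  where
  open ≡-Reasoning
  half : x / 2 < 2 ^ w
  half = m<n*o⇒m/o<n (subst (x <_) (*-comm 2 (2 ^ w)) x<2^w)
  bit₀ : ∀ y → y < 2 → (if y ≡ᵇ 1 then 1 else 0) ≡ y
  bit₀ 0 _ = refl
  bit₀ 1 _ = refl
  bit₀ (suc (suc y)) (s≤s (s≤s ()))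

-- Needed for `sub`, which adds 2 ^ w before it subtracts.
word-+2^w : ∀ w x → word w (x + 2 ^ w) ≡ word w x
word-+2^w zero    x = refl
word-+2^w (suc w) x = cong₂ (λ r y → (r ≡ᵇ 1) ∷ y) low
  (trans (cong (word w) high) (word-+2^w w (x / 2)))
  where
  open ≡-Reasoning
  2^w = 2 ^ w
  low : (x + 2 * 2^w) % 2 ≡ x % 2
  low = trans (cong (λ y → (x + y) % 2) (*-comm 2 2^w)) ([m+kn]%n≡m%n x 2^w 2)
  high : (x + 2 * 2^w) / 2 ≡ x / 2 + 2^w
  high = begin
    (x + 2 * 2^w) / 2      ≡⟨ cong (λ y → (x + y) / 2) (*-comm 2 2^w) ⟩
    (x + 2^w * 2) / 2      ≡⟨ +-distrib-/-∣ʳ x (divides-refl 2^w) ⟩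
    x / 2 + 2^w * 2 / 2    ≡⟨ cong (x / 2 +_) (m*n/n≡m 2^w 2) ⟩
    x / 2 + 2^w            ∎
    where open import Data.Nat.Divisibility using (divides-refl)

value-readBits : ∀ w ℓ v (f : ℕ → Bool) → ℓ ≤ w → (∀ j → j < ℓ → f j ≡ bit (word ℓ v) j) →
  value (tabulate {n = w} λ j → (toℕ j <ᵇ ℓ) ∧ f (toℕ j)) ≡ value (word ℓ v)
value-readBits zero    zero    v f _ _ = refl
value-readBits (suc w) zero    v f _ _ =
  cong (2 *_) (value-readBits w zero v (f ∘ suc) z≤n λ _ ())
value-readBits (suc w) (suc ℓ) v f (s≤s ℓ≤w) f≗ =
  cong₂ (λ b y → (if b then 1 else 0) + 2 * y) (f≗ 0 z<s)
    (value-readBits w ℓ (v / 2) (f ∘ suc) ℓ≤w λ j j<ℓ → f≗ (suc j) (s<s j<ℓ))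

-- The operations on numbers that a word operation performs exactly: no underflow and no zero
-- divisor. Overflow is excluded separately, by a bound on the result.
data Arith : BinOp → ℕ → ℕ → ℕ → Set where
  add : ∀ {a b} → Arith add a b (a + b)
  sub : ∀ {a b} → b ≤ a → Arith sub a b (a ∸ b)
  mul : ∀ {a b} → Arith mul a b (a * b)
  div : ∀ {a b} .{{_ : NonZero b}} → Arith div a b (a / b)
  mod : ∀ {a b} .{{_ : NonZero b}} → Arith mod a b (a % b)

evalOp-div : ∀ {w} (a b : Word w) {n} .{{_ : NonZero n}} → value b ≡ n →
             evalOp div a b ≡ word w (value a / n)
evalOp-div a b b≡n with value b
evalOp-div a b refl | suc _ = refl

evalOp-mod : ∀ {w} (a b : Word w) {n} .{{_ : NonZero n}} → value b ≡ n →
             evalOp mod a b ≡ word w (value a % n)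
evalOp-mod a b b≡n with value b
evalOp-mod a b refl | suc _ = refl

value-evalOp : ∀ {w f} (a b : Word w) {m n v} → value a ≡ m → value b ≡ n →
               Arith f m n v → v < 2 ^ w → value (evalOp f a b) ≡ v
value-evalOp {w} a b refl refl add fits = value-word w fits
value-evalOp {w} a b refl refl mul fits = value-word w fits
value-evalOp {w} a b refl refl (sub b≤a) fits = begin
  value (word w (value a + 2 ^ w ∸ value b))     ≡⟨ cong (value ∘ word w) (+-∸-comm (2 ^ w) b≤a) ⟩
  value (word w ((value a ∸ value b) + 2 ^ w))   ≡⟨ cong value (word-+2^w w _) ⟩
  value (word w (value a ∸ value b))             ≡⟨ value-word w fits ⟩
  value a ∸ value b                              ∎
  where open ≡-Reasoning
value-evalOp {w} a b refl refl div fits = trans (cong value (evalOp-div a b refl)) (value-word w fits)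
value-evalOp {w} a b refl refl mod fits = trans (cong value (evalOp-mod a b refl)) (value-word w fits)

-- Straight-line expressions and their compilation

-- Without loops and stores, `cost` bounds the running time for every input and the memory stays as
-- it is. There is no sharing: a repeated subexpression is computed again, which only enlarges the
-- constant.
data Expr : Set where
  input wordSize : Expr
  lit  : ℕ → Expr
  bin  : BinOp → Expr → Expr → Expr
  read : (address len : Expr) → Expr
  ifLt : (e₁ e₂ then else : Expr) → Expr

depth : Expr → ℕ
depth input            = 0
depth wordSize         = 0
depth (lit _)          = 0
depth (bin _ e₁ e₂)    = depth e₁ ⊔ suc (depth e₂)
depth (read e₁ e₂)     = depth e₁ ⊔ suc (depth e₂)
depth (ifLt e₁ e₂ p q) = (depth e₁ ⊔ suc (depth e₂)) ⊔ (depth p ⊔ depth q)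

cost : Expr → ℕ
cost input            = 1
cost wordSize         = 1
cost (lit _)          = 1
cost (bin _ e₁ e₂)    = (cost e₁ + cost e₂) + 1
cost (read e₁ e₂)     = (cost e₁ + cost e₂) + 1
cost (ifLt e₁ e₂ p q) = (cost e₁ + cost e₂) + suc (cost p + cost q)

-- Clamped to the last register, so that `compile` is total; correctness is claimed only where the
-- registers suffice.
reg : ∀ k → ℕ → Fin (suc k)
reg k       zero    = zero
reg zero    (suc d) = zero
reg (suc k) (suc d) = suc (reg k d)

reg-≢ : ∀ {k i d} → i < d → d ≤ k → reg k i ≢ reg k d
reg-≢ {suc k} {zero}  {suc d} _         _         ()
reg-≢ {suc k} {suc i} {suc d} (s≤s i<d) (s≤s d≤k) same = reg-≢ i<d d≤k (fsuc-injective same)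

-- Leaves the value in register d without changing lower registers; the input
-- is in register 0.
compile : ∀ k → Expr → ℕ → Program (suc k)
compile k input            d = instr (move (reg k d) zero)
compile k wordSize         d = instr (wordLen (reg k d))
compile k (lit c)          d = instr (const (reg k d) c)
compile k (bin f e₁ e₂)    d =
  (compile k e₁ d ⨾ compile k e₂ (suc d)) ⨾ instr (binop f (reg k d) (reg k d) (reg k (suc d)))
compile k (read e₁ e₂)     d =
  (compile k e₁ d ⨾ compile k e₂ (suc d)) ⨾ instr (load (reg k d) (reg k d) (reg k (suc d)))
compile k (ifLt e₁ e₂ p q) d =
  (compile k e₁ d ⨾ compile k e₂ (suc d)) ⨾
  cond (lt (reg k d) (reg k (suc d))) (compile k p d) (compile k q d)

module Evaluation (w : ℕ) (μ : Memory) (x : ℕ) where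

  infix 4 _⇓_

  -- Evaluation over ℕ, with the side conditions under which words behave like numbers. Only the
  -- branch taken has to satisfy them, so a branch may rely on the outcome of its test.
  data _⇓_ : Expr → ℕ → Set where
    input    : input ⇓ x
    wordSize : wordSize ⇓ w
    lit      : ∀ {c} → c < 2 ^ w → lit c ⇓ c
    bin      : ∀ {f e₁ e₂ a b v} → e₁ ⇓ a → e₂ ⇓ b → Arith f a b v → v < 2 ^ w → bin f e₁ e₂ ⇓ v
    read     : ∀ {e₁ e₂ a ℓ v} → e₁ ⇓ a → e₂ ⇓ ℓ → ℓ ≤ w → v < 2 ^ ℓ →
               (∀ j → j < ℓ → μ (a + j) ≡ bit (word ℓ v) j) → read e₁ e₂ ⇓ v
    ifTrue   : ∀ {e₁ e₂ p q a b v} → e₁ ⇓ a → e₂ ⇓ b → a < b → p ⇓ v → ifLt e₁ e₂ p q ⇓ v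
    ifFalse  : ∀ {e₁ e₂ p q a b v} → e₁ ⇓ a → e₂ ⇓ b → b ≤ a → q ⇓ v → ifLt e₁ e₂ p q ⇓ v

  module _ {k : ℕ} where

    Regs : Set
    Regs = Vec (Word w) (suc k)

    -- The final memory is again μ, which is how the representation survives a query. By `frame`,
    -- waiting operands and, for positive d, the input in register 0 survive as well.
    record Computes (P : Program (suc k)) (ρ : Regs) (d v T : ℕ) : Set where
      constructor computes
      field
        {time}  : ℕ
        {final} : Regs
        run     : P , (ρ , μ) ⇓[ time ] (final , μ)
        time≤T  : time ≤ T
        result  : value (lookup final (reg k d)) ≡ v
        frame   : ∀ {i} → i < d → lookup final (reg k i) ≡ lookup ρ (reg k i)

    assigned : ∀ {P : Program (suc k)} {ρ ρ′ : Regs} {d t v T} {y : Word w} → d ≤ k →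
      P , (ρ , μ) ⇓[ t ] (ρ′ [ reg k d ]≔ y , μ) → t ≤ T → value y ≡ v →
      (∀ {i} → i < d → lookup ρ′ (reg k i) ≡ lookup ρ (reg k i)) → Computes P ρ d v T
    assigned {ρ′ = ρ′} {d} {y = y} d≤k run t≤T y≡v frame =
      computes run t≤T (trans (cong value (lookup∘update (reg k d) ρ′ y)) y≡v)
        λ i<d → trans (lookup∘update′ (reg-≢ i<d d≤k) ρ′ y) (frame i<d)

    record ComputesBoth (P : Program (suc k)) (ρ : Regs) (d a b T : ℕ) : Set where
      constructor computesBoth
      field
        {time}  : ℕ
        {final} : Regs
        run     : P , (ρ , μ) ⇓[ time ] (final , μ)
        time≤T  : time ≤ T
        result₁ : value (lookup final (reg k d)) ≡ a
        result₂ : value (lookup final (reg k (suc d))) ≡ b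
        frame   : ∀ {i} → i < d → lookup final (reg k i) ≡ lookup ρ (reg k i)

    compile-correct : ∀ {e v} → e ⇓ v → ∀ d → 1 ≤ d → d + depth e ≤ k →
      ∀ ρ → value (lookup ρ zero) ≡ x → Computes (compile k e d) ρ d v (cost e)
    compile-both : ∀ {e₁ e₂ a b} → e₁ ⇓ a → e₂ ⇓ b → ∀ d → 1 ≤ d → d + (depth e₁ ⊔ suc (depth e₂)) ≤ k →
      ∀ ρ → value (lookup ρ zero) ≡ x →
      ComputesBoth (compile k e₁ d ⨾ compile k e₂ (suc d)) ρ d a b (cost e₁ + cost e₂)

    compile-both {e₁} {e₂} E₁ E₂ d 1≤d room ρ ρ₀ =
      computesBoth (⇓seq (C₁.run) (C₂.run)) (+-mono-≤ C₁.time≤T C₂.time≤T)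
        (trans (cong value (C₂.frame ≤-refl)) C₁.result) C₂.result
        λ i<d → trans (C₂.frame (m<n⇒m<1+n i<d)) (C₁.frame i<d)
      where
      module C₁ = Computes (compile-correct E₁ d 1≤d
        (≤-trans (+-monoʳ-≤ d (m≤m⊔n _ _)) room) ρ ρ₀)
      module C₂ = Computes (compile-correct E₂ (suc d) z<s
        (≤-trans (≤-trans (≤-reflexive (sym (+-suc d _))) (+-monoʳ-≤ d (m≤n⊔m (depth e₁) _))) room)
        C₁.final (trans (cong value (C₁.frame 1≤d)) ρ₀))

    compile-correct input d 1≤d room ρ ρ₀ =
      assigned (≤-trans (m≤m+n d _) room) ⇓instr ≤-refl ρ₀ λ _ → refl
    compile-correct wordSize d 1≤d room ρ ρ₀ =
      assigned (≤-trans (m≤m+n d _) room) ⇓instr ≤-refl (value-word w (n<2^n w)) λ _ → refl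
    compile-correct (lit c<) d 1≤d room ρ ρ₀ =
      assigned (≤-trans (m≤m+n d _) room) ⇓instr ≤-refl (value-word w c<) λ _ → refl
    compile-correct (bin E₁ E₂ ar v<) d 1≤d room ρ ρ₀ =
      assigned (≤-trans (m≤m+n d _) room) (⇓seq run ⇓instr) (+-monoˡ-≤ 1 time≤T)
        (value-evalOp _ _ result₁ result₂ ar v<) frame
      where open ComputesBoth (compile-both E₁ E₂ d 1≤d room ρ ρ₀)
    compile-correct (read {ℓ = ℓ} {v} E₁ E₂ ℓ≤w v< bits) d 1≤d room ρ ρ₀ =
      assigned (≤-trans (m≤m+n d _) room) (⇓seq run ⇓instr) (+-monoˡ-≤ 1 time≤T) correct frame
      where
      open ComputesBoth (compile-both E₁ E₂ d 1≤d room ρ ρ₀)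
      correct : value (readBits {w} μ (value (lookup final (reg k d))) (value (lookup final (reg k (suc d))))) ≡ v
      correct rewrite result₁ | result₂ =
        trans (value-readBits w ℓ v _ ℓ≤w bits) (value-word ℓ v<)
    compile-correct (ifTrue {e₁} {e₂} {p} {q} {a} {b} E₁ E₂ a<b E) d 1≤d room ρ ρ₀ =
      computes (⇓seq B.run (⇓then taken C.run))
        (+-mono-≤ B.time≤T (s≤s (≤-trans C.time≤T (m≤m+n _ _)))) C.result
        λ i<d → trans (C.frame i<d) (B.frame i<d)
      where
      module B = ComputesBoth (compile-both E₁ E₂ d 1≤d (≤-trans (+-monoʳ-≤ d (m≤m⊔n _ _)) room) ρ ρ₀)
      module C = Computes (compile-correct E d 1≤d
        (≤-trans (+-monoʳ-≤ d (≤-trans (m≤m⊔n _ _) (m≤n⊔m (depth e₁ ⊔ suc (depth e₂)) _))) room)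
        B.final (trans (cong value (B.frame 1≤d)) ρ₀))
      taken : test (lt (reg k d) (reg k (suc d))) (B.final , μ) ≡ true
      taken rewrite B.result₁ | B.result₂ = dec-true (a <? b) a<b
    compile-correct (ifFalse {e₁} {e₂} {p} {q} {a} {b} E₁ E₂ b≤a E) d 1≤d room ρ ρ₀ =
      computes (⇓seq B.run (⇓else taken C.run))
        (+-mono-≤ B.time≤T (s≤s (≤-trans C.time≤T (m≤n+m _ (cost p))))) C.result
        λ i<d → trans (C.frame i<d) (B.frame i<d)
      where
      module B = ComputesBoth (compile-both E₁ E₂ d 1≤d (≤-trans (+-monoʳ-≤ d (m≤m⊔n _ _)) room) ρ ρ₀)
      module C = Computes (compile-correct E d 1≤d
        (≤-trans (+-monoʳ-≤ d (≤-trans (m≤n⊔m (depth p) _) (m≤n⊔m (depth e₁ ⊔ suc (depth e₂)) _))) room)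
        B.final (trans (cong value (B.frame 1≤d)) ρ₀))
      taken : test (lt (reg k d) (reg k (suc d))) (B.final , μ) ≡ false
      taken rewrite B.result₁ | B.result₂ = dec-false (a <? b) (≤⇒≯ b≤a)

-- Bit fields of a memory representation

-- Out of range, this is false.
_!_ : List Bool → ℕ → Bool
[]       ! j     = false
(b ∷ bs) ! zero  = b
(b ∷ bs) ! suc j = bs ! j

lookup-! : ∀ D (j : Fin (length D)) → List.lookup D j ≡ D ! toℕ j
lookup-! (b ∷ D) zero    = refl
lookup-! (b ∷ D) (suc j) = lookup-! D j

!-++ˡ : ∀ D {D′ j} → j < length D → (D ++ D′) ! j ≡ D ! j
!-++ˡ (b ∷ D) {j = zero}  _         = refl
!-++ˡ (b ∷ D) {j = suc j} (s≤s j<D) = !-++ˡ D j<D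

!-++ʳ : ∀ D {D′} j → (D ++ D′) ! (length D + j) ≡ D′ ! j
!-++ʳ []      j = refl
!-++ʳ (b ∷ D) j = !-++ʳ D j

record Field (D : List Bool) (a ℓ v : ℕ) : Set where
  constructor field′
  field
    inside : a + ℓ ≤ length D
    bits   : ∀ j → j < ℓ → D ! (a + j) ≡ bit (word ℓ v) j

Field-++ˡ : ∀ {D D′ a ℓ v} → Field D a ℓ v → Field (D ++ D′) a ℓ v
Field-++ˡ {D} {D′} {a} (field′ inside bits) = field′
  (≤-trans inside (≤-trans (m≤m+n _ _) (≤-reflexive (sym (length-++ D)))))
  λ j j<ℓ → trans (!-++ˡ D (<-≤-trans (+-monoʳ-< a j<ℓ) inside)) (bits j j<ℓ)

Field-++ʳ : ∀ D {D′ a ℓ v} → Field D′ a ℓ v → Field (D ++ D′) (length D + a) ℓ v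
Field-++ʳ D {D′} {a} {ℓ} (field′ inside bits) = field′
  (subst₂ _≤_ (sym (+-assoc (length D) a ℓ)) (sym (length-++ D)) (+-monoʳ-≤ (length D) inside))
  λ j j<ℓ → trans (cong ((D ++ D′) !_) (+-assoc (length D) a j))
                  (trans (!-++ʳ D (a + j)) (bits j j<ℓ))

toList-! : ∀ {w} (v : Word w) j → toList v ! j ≡ bit v j
toList-! []      j       = refl
toList-! (b ∷ v) zero    = refl
toList-! (b ∷ v) (suc j) = toList-! v j

Field-word : ∀ ℓ v → Field (toList (word ℓ v)) 0 ℓ v
Field-word ℓ v = field′ (≤-reflexive (sym (length-toList (word ℓ v)))) λ j _ → toList-! (word ℓ v) j

concat< : (ℕ → List Bool) → ℕ → List Bool
concat< g zero    = []
concat< g (suc c) = g 0 ++ concat< (g ∘ suc) c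

length-concat< : ∀ g c → length (concat< g c) ≡ sum< (length ∘ g) c
length-concat< g zero    = refl
length-concat< g (suc c) =
  trans (length-++ (g 0)) (cong (length (g 0) +_) (length-concat< (g ∘ suc) c))

Field-concat< : ∀ g c {i a ℓ v} → i < c → Field (g i) a ℓ v →
                Field (concat< g c) (sum< (length ∘ g) i + a) ℓ v
Field-concat< g (suc c) {zero}          _         F = Field-++ˡ F
Field-concat< g (suc c) {suc i} {a} {ℓ} {v} (s≤s i<c) F =
  subst (λ a′ → Field (concat< g (suc c)) a′ ℓ v) (sym (+-assoc (length (g 0)) _ a))
    (Field-++ʳ (g 0) (Field-concat< (g ∘ suc) c i<c F))

-- Widths may vary for the sake of the block codes; an entry starts at the partial sum of the
-- widths, which for the codes is `pointer`.
array : (width entry : ℕ → ℕ) → ℕ → List Bool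
array width entry = concat< λ i → toList (word (width i) (entry i))

length-array : ∀ width entry c → length (array width entry c) ≡ sum< width c
length-array width entry c =
  trans (length-concat< _ c) (sum<-cong c λ i _ → length-toList (word (width i) (entry i)))

Field-array : ∀ width entry {c i} → i < c →
              Field (array width entry c) (sum< width i) (width i) (entry i)
Field-array width entry {c} {i} i<c =
  subst (λ a → Field (array width entry c) a (width i) (entry i))
    (trans (+-identityʳ _) (sum<-cong i λ j _ → length-toList (word (width j) (entry j))))
    (Field-concat< (λ j → toList (word (width j) (entry j))) c i<c (Field-word (width i) (entry i)))

Stores-Field : ∀ {μ D a ℓ v} → Stores μ D → Field D a ℓ v →
               ∀ j → j < ℓ → μ (a + j) ≡ bit (word ℓ v) j
Stores-Field {μ} {D} {a} {ℓ} stored (field′ inside bits) j j<ℓ = begin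
  μ (a + j)                         ≡⟨ cong μ (toℕ-fromℕ< a+j<D) ⟨
  μ (toℕ (fromℕ< a+j<D))            ≡⟨ stored (fromℕ< a+j<D) ⟩
  List.lookup D (fromℕ< a+j<D)      ≡⟨ lookup-! D _ ⟩
  D ! toℕ (fromℕ< a+j<D)            ≡⟨ cong (D !_) (toℕ-fromℕ< a+j<D) ⟩
  D ! (a + j)                       ≡⟨ bits j j<ℓ ⟩
  bit (word ℓ _) j                  ∎
  where
  open ≡-Reasoning
  a+j<D : a + j < length D
  a+j<D = <-≤-trans (+-monoʳ-< a j<ℓ) inside

-- Rank and select of a characteristic sequence

[_]₁ : Bool → ℕ
[ b ]₁ = if b then 1 else 0

ones : (ℕ → Bool) → ℕ → ℕ
ones σ = sum< λ j → [ σ j ]₁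

filter-map : ∀ {A B : Set} {P : B → Set} {Q : A → Set} (P? : Decidable P) (Q? : Decidable Q) (f : A → B) →
  (∀ x → does (P? (f x)) ≡ does (Q? x)) → ∀ xs → filter P? (List.map f xs) ≡ List.map f (filter Q? xs)
filter-map P? Q? f same [] = refl
filter-map P? Q? f same (x ∷ xs) rewrite same x with does (Q? x)
... | true  = cong (f x ∷_) (filter-map P? Q? f same xs)
... | false = filter-map P? Q? f same xs

later-elements : ∀ {n} b (S : Subset n) →
                 filter (_∈? (b ∷ S)) (List.tabulate suc) ≡ List.map suc (elements S)
later-elements b S = trans (cong (filter (_∈? (b ∷ S))) (sym (map-tabulate (λ x → x) suc)))
                           (filter-map (_∈? (b ∷ S)) (_∈? S) suc (λ _ → refl) (allFin _))

rank-suc : ∀ {n} (x : Fin n) S →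
  length (filter (_≤? suc x) (List.map suc (elements S))) ≡ rank x S
rank-suc x S = trans (cong length (filter-map (_≤? suc x) (_≤? x) suc same (elements S)))
                     (length-map suc (filter (_≤? x) (elements S)))
  where
  same : ∀ y → does (suc y ≤? suc x) ≡ does (y ≤? x)
  same zero    = refl
  same (suc y) = refl

none-≤-zero : ∀ {n} (xs : List (Fin n)) → length (filter (_≤? zero {n}) (List.map suc xs)) ≡ 0
none-≤-zero []       = refl
none-≤-zero (x ∷ xs) = none-≤-zero xs

rank≡ones : ∀ {n} (x : Fin n) (S : Subset n) → rank x S ≡ ones (bit S) (suc (toℕ x))
rank≡ones zero    (true  ∷ S) rewrite later-elements true S = cong suc (none-≤-zero (elements S))
rank≡ones zero    (false ∷ S) rewrite later-elements false S = none-≤-zero (elements S)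
rank≡ones (suc x) (true  ∷ S) rewrite later-elements true S =
  cong suc (trans (rank-suc x S) (rank≡ones x S))
rank≡ones (suc x) (false ∷ S) rewrite later-elements false S =
  trans (rank-suc x S) (rank≡ones x S)

lookup-map-suc : ∀ {n} (xs : List (Fin n)) (i : Fin (length (List.map Fin.suc xs))) →
  ∃[ j ] (toℕ j ≡ toℕ i × List.lookup (List.map suc xs) i ≡ suc (List.lookup xs j))
lookup-map-suc (x ∷ xs) zero    = zero , refl , refl
lookup-map-suc (x ∷ xs) (suc i) with lookup-map-suc xs i
... | j , j≡i , found = suc j , cong suc j≡i , found

-- These two properties determine the position, so it is enough for the program to find a one that
-- has `toℕ i` ones before it.
select-correct : ∀ {n} (S : Subset n) (i : Fin (length (elements S))) →
  bit S (toℕ (select S i)) ≡ true × ones (bit S) (toℕ (select S i)) ≡ toℕ i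
select-correct (true ∷ S) i rewrite later-elements true S with i
... | zero  = refl , refl
... | suc i′ with lookup-map-suc (elements S) i′
...   | j , j≡i , found rewrite found with select-correct S j
...     | member , count = member , cong suc (trans count j≡i)
select-correct (false ∷ S) i rewrite later-elements false S with lookup-map-suc (elements S) i
... | j , j≡i , found rewrite found with select-correct S j
...   | member , count = member , trans count j≡i

size≡ones : ∀ {n} (S : Subset n) → ∣ S ∣ ≡ ones (bit S) n
size≡ones []          = refl
size≡ones (true  ∷ S) = cong suc (size≡ones S)
size≡ones (false ∷ S) = size≡ones S

-- Logarithms

n<2^[1+log] : ∀ n → n < 2 ^ suc ⌊log₂ n ⌋
n<2^[1+log] n = ≰⇒> λ 2^≤n → <⇒≱ (n<1+n ⌊log₂ n ⌋)
  (subst (_≤ ⌊log₂ n ⌋) (⌊log₂[2^n]⌋≡n (suc ⌊log₂ n ⌋)) (⌊log₂⌋-mono-≤ 2^≤n))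

2*⌊n/2⌋≤n : ∀ n → 2 * ⌊ n /2⌋ ≤ n
2*⌊n/2⌋≤n n = begin
  ⌊ n /2⌋ + (⌊ n /2⌋ + 0)  ≡⟨ cong (⌊ n /2⌋ +_) (+-identityʳ _) ⟩
  ⌊ n /2⌋ + ⌊ n /2⌋        ≤⟨ +-monoʳ-≤ ⌊ n /2⌋ (⌊n/2⌋≤⌈n/2⌉ n) ⟩
  ⌊ n /2⌋ + ⌈ n /2⌉        ≡⟨ ⌊n/2⌋+⌈n/2⌉≡n n ⟩
  n                        ∎
  where open ≤-Reasoning

2^log≤n : ∀ n .{{_ : NonZero n}} → 2 ^ ⌊log₂ n ⌋ ≤ n
2^log≤n n = go ⌊log₂ n ⌋ n refl
  where
  go : ∀ k n .{{_ : NonZero n}} → ⌊log₂ n ⌋ ≡ k → 2 ^ k ≤ n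
  go zero    n _ = >-nonZero⁻¹ n
  go (suc k) n@(suc (suc _)) log≡ = ≤-trans
    (*-monoʳ-≤ 2 (go k ⌊ n /2⌋ (trans (⌊log₂⌊n/2⌋⌋≡⌊log₂n⌋∸1 n) (cong pred log≡))))
    (2*⌊n/2⌋≤n n)

-- Weights of bit sequences

ones-≤ : ∀ σ i → ones σ i ≤ i
ones-≤ σ i = subst (ones σ i ≤_) (*-identityʳ i) (sum<-≤ i λ j _ → [σ]≤1 (σ j))
  where
  [σ]≤1 : ∀ b → [ b ]₁ ≤ 1
  [σ]≤1 true  = ≤-refl
  [σ]≤1 false = z≤n

ones+zeros : ∀ σ i → ones σ i + ones (not ∘ σ) i ≡ i
ones+zeros σ zero    = refl
ones+zeros σ (suc i) with σ 0
... | true  = cong suc (ones+zeros (σ ∘ suc) i)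
... | false = trans (+-suc _ _) (cong suc (ones+zeros (σ ∘ suc) i))

module Weights (p q : ℕ) where

  -- This is (p + q) ^ i times the probability of the prefix when bits are independent and ones have
  -- probability p / (p + q); the scaling keeps everything in ℕ.
  weight : (ℕ → Bool) → ℕ → ℕ
  weight σ i = p ^ ones σ i * q ^ ones (not ∘ σ) i

  weight-+ : ∀ σ a c → weight σ (a + c) ≡ weight σ a * weight (λ j → σ (a + j)) c
  weight-+ σ a c = begin
    p ^ ones σ (a + c) * q ^ ones (not ∘ σ) (a + c)
      ≡⟨ cong₂ (λ x y → p ^ x * q ^ y) (sum<-+ _ a c) (sum<-+ _ a c) ⟩
    p ^ (x + x′) * q ^ (y + y′)
      ≡⟨ cong₂ _*_ (^-distribˡ-+-* p x x′) (^-distribˡ-+-* q y y′) ⟩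
    (p ^ x * p ^ x′) * (q ^ y * q ^ y′)
      ≡⟨ [m*n]*[o*p]≡[m*o]*[n*p] (p ^ x) _ _ _ ⟩
    (p ^ x * q ^ y) * (p ^ x′ * q ^ y′) ∎
    where
    open ≡-Reasoning
    x = ones σ a
    x′ = ones (λ j → σ (a + j)) c
    y = ones (not ∘ σ) a
    y′ = ones (λ j → not (σ (a + j))) c

  weight-≤ : ∀ σ i → weight σ i ≤ (p + q) ^ i
  weight-≤ σ i = begin
    p ^ ones σ i * q ^ ones (not ∘ σ) i
      ≤⟨ *-mono-≤ (^-monoˡ-≤ (ones σ i) (m≤m+n p q)) (^-monoˡ-≤ (ones (not ∘ σ) i) (m≤n+m q p)) ⟩
    (p + q) ^ ones σ i * (p + q) ^ ones (not ∘ σ) i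
      ≡⟨ ^-distribˡ-+-* (p + q) (ones σ i) _ ⟨
    (p + q) ^ (ones σ i + ones (not ∘ σ) i)
      ≡⟨ cong ((p + q) ^_) (ones+zeros σ i) ⟩
    (p + q) ^ i ∎
    where open ≤-Reasoning

  weight-cong-ones : ∀ σ τ i → ones σ i ≡ ones τ i → weight σ i ≡ weight τ i
  weight-cong-ones σ τ i same = cong₂ (λ x y → p ^ x * q ^ y) same
    (+-cancelˡ-≡ (ones σ i) _ _
      (trans (ones+zeros σ i) (trans (sym (ones+zeros τ i)) (cong (_+ ones (not ∘ τ) i) (sym same)))))

-- Enumerative codes for the words with a given number of ones

words : ∀ b → List (Word b)
words zero    = [] ∷ []
words (suc b) = List.map (true ∷_) (words b) ++ List.map (false ∷_) (words b)

∈-words : ∀ {b} (v : Word b) → v ∈ words b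
∈-words []          = here refl
∈-words (true  ∷ v) = ∈-++⁺ˡ (∈-map⁺ (true ∷_) (∈-words v))
∈-words (false ∷ v) = ∈-++⁺ʳ (List.map (true ∷_) (words _)) (∈-map⁺ (false ∷_) (∈-words v))

length-words : ∀ b → length (words b) ≡ 2 ^ b
length-words zero    = refl
length-words (suc b) = begin
  length (List.map (true ∷_) (words b) ++ List.map (false ∷_) (words b))
    ≡⟨ length-++ (List.map (true ∷_) (words b)) ⟩
  length (List.map (true ∷_) (words b)) + length (List.map (false ∷_) (words b))
    ≡⟨ cong₂ _+_ (length-map _ (words b)) (length-map _ (words b)) ⟩
  length (words b) + length (words b)
    ≡⟨ cong₂ _+_ (length-words b) (trans (length-words b) (sym (+-identityʳ (2 ^ b)))) ⟩
  2 ^ suc b ∎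
  where open ≡-Reasoning

size : ∀ {b} → Word b → ℕ
size {b} v = ones (bit v) b

hasSize? : ∀ b c → Decidable (λ (v : Word b) → size v ≡ c)
hasSize? b c v = size v ≟ c

class : ∀ b → ℕ → List (Word b)
class b c = filter (hasSize? b c) (words b)

∈-class : ∀ {b} (v : Word b) → v ∈ class b (size v)
∈-class {b} v = ∈-filter⁺ (hasSize? b (size v)) (∈-words v) refl

code : ∀ {b} → Word b → ℕ
code v = toℕ (index (∈-class v))

codeLength : ℕ → ℕ → ℕ
codeLength b c = suc ⌊log₂ length (class b c) ⌋

nth : ∀ {A : Set} → A → List A → ℕ → A
nth d []       _       = d
nth d (x ∷ xs) zero    = x
nth d (x ∷ xs) (suc o) = nth d xs o

nth-lookup : ∀ {A : Set} (d : A) xs (i : Fin (length xs)) → nth d xs (toℕ i) ≡ List.lookup xs i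
nth-lookup d (x ∷ xs) zero    = refl
nth-lookup d (x ∷ xs) (suc i) = nth-lookup d xs i

-- The zero word if o is not a code.
decode : ∀ b → ℕ → ℕ → Word b
decode b c o = nth (Vec.replicate b false) (class b c) o

decode-code : ∀ {b} (v : Word b) → decode b (size v) (code v) ≡ v
decode-code {b} v = trans (nth-lookup _ (class b (size v)) (index (∈-class v))) (sym (lookup-index (∈-class v)))

code<∣class∣ : ∀ {b} (v : Word b) → code v < length (class b (size v))
code<∣class∣ v = toℕ<n (index (∈-class v))

code<2^codeLength : ∀ {b} (v : Word b) → code v < 2 ^ codeLength b (size v)
code<2^codeLength v = <-trans (code<∣class∣ v) (n<2^[1+log] _)

∣class∣≤2^b : ∀ b c → length (class b c) ≤ 2 ^ b
∣class∣≤2^b b c = subst (length (class b c) ≤_) (length-words b) (length-filter (hasSize? b c) (words b))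

codeLength-≤ : ∀ b c → codeLength b c ≤ suc b
codeLength-≤ b c = s≤s (subst (⌊log₂ length (class b c) ⌋ ≤_) (⌊log₂[2^n]⌋≡n b) (⌊log₂⌋-mono-≤ (∣class∣≤2^b b c)))

module _ (p q : ℕ) where
  open Weights p q

  -- The expansion of a b-fold product of p + q: the first bit of a word picks the term p or q of
  -- the first factor.
  sum-weight-words : ∀ b → sum (List.map (λ v → weight (bit v) b) (words b)) ≡ (p + q) ^ b
  sum-weight-words zero    = refl
  sum-weight-words (suc b) = begin
    sum (List.map (λ v → weight (bit v) (suc b)) (words (suc b)))
      ≡⟨ cong sum (map-++ _ (List.map (true ∷_) (words b)) _) ⟩
    sum (List.map _ (List.map (true ∷_) (words b)) ++ List.map _ (List.map (false ∷_) (words b)))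
      ≡⟨ sum-++ (List.map _ (List.map (true ∷_) (words b))) _ ⟩
    sum (List.map _ (List.map (true ∷_) (words b))) + sum (List.map _ (List.map (false ∷_) (words b)))
      ≡⟨ cong₂ _+_ (scaled true p λ v → *-assoc p _ _)
                   (scaled false q λ v → swap (p ^ ones (bit v) b) q _) ⟩
    p * (p + q) ^ b + q * (p + q) ^ b
      ≡⟨ *-distribʳ-+ ((p + q) ^ b) p q ⟨
    (p + q) ^ suc b ∎
    where
    open ≡-Reasoning
    swap : ∀ x y z → x * (y * z) ≡ y * (x * z)
    swap = solve-∀
    sum-map-* : ∀ c (vs : List (Word b)) →
      sum (List.map (λ v → c * weight (bit v) b) vs) ≡ c * sum (List.map (λ v → weight (bit v) b) vs)
    sum-map-* c []       = sym (*-zeroʳ c)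
    sum-map-* c (v ∷ vs) = trans (cong (c * weight (bit v) b +_) (sum-map-* c vs)) (sym (*-distribˡ-+ c _ _))
    scaled : ∀ x c → (∀ (v : Word b) → weight (bit (x ∷ v)) (suc b) ≡ c * weight (bit v) b) →
      sum (List.map (λ v → weight (bit v) (suc b)) (List.map (x ∷_) (words b))) ≡ c * (p + q) ^ b
    scaled x c factor = begin
      sum (List.map (λ v → weight (bit v) (suc b)) (List.map (x ∷_) (words b)))  ≡⟨ cong sum (map-∘ (words b)) ⟨
      sum (List.map (λ v → weight (bit (x ∷ v)) (suc b)) (words b))              ≡⟨ cong sum (map-cong factor (words b)) ⟩
      sum (List.map (λ v → c * weight (bit v) b) (words b))                      ≡⟨ sum-map-* c (words b) ⟩
      c * sum (List.map (λ v → weight (bit v) b) (words b))                      ≡⟨ cong (c *_) (sum-weight-words b) ⟩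
      c * (p + q) ^ b                                                            ∎

  -- Words of the same class have the same weight, and all weights sum to (p + q) ^ b.
  class-weight-≤ : ∀ {b} (v : Word b) → length (class b (size v)) * weight (bit v) b ≤ (p + q) ^ b
  class-weight-≤ {b} v = subst (length (class b (size v)) * weight (bit v) b ≤_) (sum-weight-words b) (go (words b))
    where
    go : ∀ vs → length (filter (hasSize? b (size v)) vs) * weight (bit v) b ≤ sum (List.map (λ v → weight (bit v) b) vs)
    go []       = z≤n
    go (u ∷ vs) with size u ≟ size v
    ... | yes same rewrite filter-accept (hasSize? b (size v)) {u} {vs} same = +-mono-≤ (≤-reflexive (weight-cong-ones (bit v) (bit u) b (sym same))) (go vs)
    ... | no other rewrite filter-reject (hasSize? b (size v)) {u} {vs} other = ≤-trans (go vs) (m≤n+m _ (weight (bit u) b))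

-- Quotients

/-unique : ∀ a {r} K .{{_ : NonZero K}} → r < K → (a * K + r) / K ≡ a
/-unique a {r} K r<K = begin
  (a * K + r) / K      ≡⟨ cong (_/ K) (+-comm (a * K) r) ⟩
  (r + a * K) / K      ≡⟨ +-distrib-/-∣ʳ r (divides-refl a) ⟩
  r / K + a * K / K    ≡⟨ cong₂ _+_ (m<n⇒m/n≡0 r<K) (m*n/n≡m a K) ⟩
  a                    ∎
  where open ≡-Reasoning

%-unique : ∀ a {r} K .{{_ : NonZero K}} → r < K → (a * K + r) % K ≡ r
%-unique a {r} K r<K = begin
  (a * K + r) % K   ≡⟨ cong (_% K) (+-comm (a * K) r) ⟩
  (r + a * K) % K   ≡⟨ [m+kn]%n≡m%n r a K ⟩
  r % K             ≡⟨ m<n⇒m%n≡m r<K ⟩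
  r                 ∎
  where open ≡-Reasoning

/*+% : ∀ m K .{{_ : NonZero K}} → m / K * K + m % K ≡ m
/*+% m K = trans (+-comm (m / K * K) (m % K)) (sym (m≡m%n+[m/n]*n m K))

m<[1+m/K]*K : ∀ m K .{{_ : NonZero K}} → m < (m / K + 1) * K
m<[1+m/K]*K m K = begin-strict
  m                    ≡⟨ /*+% m K ⟨
  m / K * K + m % K    <⟨ +-monoʳ-< (m / K * K) (m%n<n m K) ⟩
  m / K * K + K        ≡⟨ +-comm (m / K * K) K ⟩
  K + m / K * K        ≡⟨ cong (_* K) (+-comm 1 (m / K)) ⟩
  (m / K + 1) * K      ∎
  where open ≤-Reasoning

-- A boundary B inside the group of i names that group, and `i % K` names the member. So a table
-- indexed by the boundary and `i % K` can hold the answer for i.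
same-quotient : ∀ {i B} K .{{_ : NonZero K}} → i / K * K ≤ B → B ≤ i → B / K * K + i % K ≡ i
same-quotient {i} {B} K lo hi = trans (cong (λ j → j * K + i % K) B/K≡i/K) (/*+% i K)
  where
  B/K≡i/K : B / K ≡ i / K
  B/K≡i/K = ≤-antisym (/-monoˡ-≤ K hi) (subst (_≤ B / K) (m*n/n≡m (i / K) K) (/-monoˡ-≤ K lo))

-- Finding the block of the i-th one

module BlockSearch (R : ℕ → ℕ) (R-zero : R 0 ≡ 0) (R-mono : ∀ {i j} → i ≤ j → R i ≤ R j) (N : ℕ)
  (Q K₂ d : ℕ) .{{_ : NonZero Q}} .{{_ : NonZero K₂}} .{{_ : NonZero (d * K₂)}} where

  K₁ : ℕ
  K₁ = d * K₂

  find : ℕ → ℕ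
  find = locate R N

  find-correct : ∀ {i} → i < R N → find i < N × R (find i) ≤ i × i < R (find i + 1)
  find-correct {i} i<R with locate-correct R N (subst (_≤ i) (sym R-zero) z≤n) i<R
  ... | <N , lo , hi = <N , lo , subst (λ k → i < R k) (+-comm 1 (find i)) hi

  find-unique : ∀ {i k} → i < R N → R k ≤ i → i < R (k + 1) → k ≡ find i
  find-unique {i} {k} i<R lo hi with find-correct i<R
  ... | _ , lo′ , hi′ = bracket-unique R R-mono lo (subst (λ j → i < R j) (+-comm k 1) hi)
                          lo′ (subst (λ j → i < R j) (+-comm (find i) 1) hi′)

  find-mono : ∀ {i i′} → i ≤ i′ → i′ < R N → find i ≤ find i′
  find-mono {i} {i′} i≤i′ i′<R = bracket-mono R R-mono i≤i′
    (proj₁ (proj₂ (find-correct (≤-<-trans i≤i′ i′<R))))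
    (subst (λ j → i′ < R j) (+-comm (find i′) 1) (proj₂ (proj₂ (find-correct i′<R))))

  module _ {i} (i<R : i < R N) where

    private
      i₁ = i / K₁ * K₁
      i₂ = i / K₂ * K₂
      q  = find i₁ / Q

    -- K₂ divides K₁, so the coarse sample is itself a multiple of K₂ and cannot lie after the fine
    -- one.
    i₁≤i₂ : i₁ ≤ i₂
    i₁≤i₂ = begin
      i / K₁ * (d * K₂)              ≡⟨ *-assoc (i / K₁) d K₂ ⟨
      i / K₁ * d * K₂                ≡⟨ cong (_* K₂) (m*n/n≡m (i / K₁ * d) K₂) ⟨
      i / K₁ * d * K₂ / K₂ * K₂      ≤⟨ *-monoˡ-≤ K₂ (/-monoˡ-≤ K₂ (subst (_≤ i) (sym (*-assoc (i / K₁) d K₂)) (m/n*n≤m i K₁))) ⟩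
      i / K₂ * K₂                    ∎
      where open ≤-Reasoning

    i₂≤i : i₂ ≤ i
    i₂≤i = m/n*n≤m i K₂

    -- As `find` is monotone, the block of j lies between those of i₁ and i, both in superblock q;
    -- hence the lower level stores remainders modulo Q only. It is applied to j = i₂ and to j = i.
    near : i < R ((q + 1) * Q) → ∀ {j} → i₁ ≤ j → j ≤ i → q * Q + find j % Q ≡ find j
    near i<bd {j} i₁≤j j≤i = trans (cong (λ q′ → q′ * Q + find j % Q) (sym same)) (/*+% (find j) Q)
      where
      find-i< : find i < (q + 1) * Q
      find-i< = ≰⇒> λ ≤find → <⇒≱ i<bd (≤-trans (R-mono ≤find) (proj₁ (proj₂ (find-correct i<R))))
      same : find j / Q ≡ q
      same = ≤-antisym
        (s≤s⁻¹ (subst (find j / Q <_) (+-comm q 1)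
          (m<n*o⇒m/o<n (≤-<-trans (find-mono j≤i i<R) find-i<))))
        (/-monoˡ-≤ Q (find-mono i₁≤j (≤-<-trans j≤i i<R)))

    -- The sample i₁ lies in superblock q, so the end of that superblock falls after i₁ and not
    -- after i, hence in the same group of K₁ ones.
    far : R ((q + 1) * Q) ≤ i → find (R ((q + 1) * Q) / K₁ * K₁ + i % K₁) ≡ find i
    far bd≤i = cong find (same-quotient K₁ (<⇒≤ i₁<bd) bd≤i)
      where
      i₁<bd : i₁ < R ((q + 1) * Q)
      i₁<bd = <-≤-trans (proj₂ (proj₂ (find-correct (≤-<-trans (m/n*n≤m i K₁) i<R))))
        (R-mono (subst (_≤ (q + 1) * Q) (+-comm 1 (find i₁)) (m<[1+m/K]*K (find i₁) Q)))

    within : i < R (find i₂ + 1) → find i₂ ≡ find i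
    within = find-unique i<R (≤-trans (proj₁ (proj₂ (find-correct (≤-<-trans i₂≤i i<R)))) i₂≤i)

    later : R (find i₂ + 1) ≤ i → find (R (find i₂ + 1) / K₂ * K₂ + i % K₂) ≡ find i
    later bd≤i = cong find (same-quotient K₂
      (<⇒≤ (proj₂ (proj₂ (find-correct (≤-<-trans i₂≤i i<R))))) bd≤i)

-- Blocks of a characteristic sequence

module Blocks (b : ℕ) (σ : ℕ → Bool) where

  -- Since σ is total, the last block may reach beyond n. For `bit S` the bits there are false, so
  -- the padding adds no ones.
  block : ℕ → Word b
  block k = tabulate λ j → σ (k * b + toℕ j)

  R : ℕ → ℕ
  R k = ones σ (k * b)

  R-mono : ∀ {i j} → i ≤ j → R i ≤ R j
  R-mono i≤j = sum<-mono-≤ _ (*-monoˡ-≤ b i≤j)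

  bit-tabulate : ∀ {w} (f : ℕ → Bool) j → j < w → bit {w} (tabulate (f ∘ toℕ)) j ≡ f j
  bit-tabulate {suc w} f zero    _         = refl
  bit-tabulate {suc w} f (suc j) (s≤s j<w) = bit-tabulate (f ∘ suc) j j<w

  bit-block : ∀ k j → j < b → bit (block k) j ≡ σ (k * b + j)
  bit-block k j = bit-tabulate (λ j → σ (k * b + j)) j

  ones-block : ∀ k {p} → p ≤ b → ones σ (k * b + p) ≡ R k + ones (bit (block k)) p
  ones-block k {p} p≤b = trans (sum<-+ _ (k * b) p)
    (cong (R k +_) (sum<-cong p λ j j<p → cong [_]₁ (sym (bit-block k j (<-≤-trans j<p p≤b)))))

  R-suc : ∀ k → R (k + 1) ≡ R k + size (block k)
  R-suc k = trans (cong (ones σ) (trans (cong (_* b) (+-comm k 1)) (+-comm b (k * b)))) (ones-block k ≤-refl)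

  blockLength : ℕ → ℕ
  blockLength k = codeLength b (size (block k))

  pointer : ℕ → ℕ
  pointer = sum< blockLength

-- Programs

-- Numbers 0 to 11 are the sections in memory order, whose starts fill the first header words; 12 to
-- 17 are the parameters in the remaining ones. The codes come last, so that the first eleven
-- sections form a redundancy independent of S.
pattern header        = 0
pattern rankAbs       = 1
pattern rankRel       = 2
pattern pointerAbs    = 3
pattern pointerRel    = 4
pattern coarse        = 5
pattern coarseSpan    = 6
pattern fine          = 7
pattern fineSpan      = 8
pattern rankTable     = 9
pattern selectTable   = 10
pattern codes         = 11
pattern narrowWidth   = 12
pattern blockSize     = 13
pattern superblock    = 14
pattern coarseStep    = 15
pattern fineStep      = 16
pattern tableRow      = 17

infixl 6 _⊕_ _⊖_
infixl 7 _⊗_ _⊘_ _⊛_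

_⊕_ _⊖_ _⊗_ _⊘_ _⊛_ : Expr → Expr → Expr
_⊕_ = bin add
_⊖_ = bin sub
_⊗_ = bin mul
_⊘_ = bin div
_⊛_ = bin mod

-- Word j of the header: the start of section j or, for j ≥ 12, a parameter.
param : ℕ → Expr
param j = read (lit j ⊗ wordSize) wordSize

element : Expr → ℕ → Expr → Expr
element width a i = read (param a ⊕ i ⊗ width) width

wide narrow : ℕ → Expr → Expr
wide   = element wordSize
narrow = element (param narrowWidth)

twoLevel : ℕ → ℕ → Expr → Expr
twoLevel abs rel k = wide abs (k ⊘ param superblock) ⊕ narrow rel k

rankAt pointerAt : Expr → Expr
rankAt    = twoLevel rankAbs rankRel
pointerAt = twoLevel pointerAbs pointerRel

-- The program evaluates no logarithm or binomial coefficient: the number of ones is a difference of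
-- successive ranks, and the length of the code a difference of successive pointers.
inTable : ℕ → Expr → Expr → Expr
inTable t k p = narrow t ((count ⊗ param tableRow ⊕ offset) ⊗ param blockSize ⊕ p)
  where
  count  = rankAt (k ⊕ lit 1) ⊖ rankAt k
  offset = read (param codes ⊕ pointerAt k) (pointerAt (k ⊕ lit 1) ⊖ pointerAt k)

rankExpr : Expr
rankExpr = rankAt k ⊕ inTable rankTable k (input ⊛ param blockSize)
  where k = input ⊘ param blockSize

superblockOf : Expr → Expr
superblockOf i = wide coarse (i ⊘ param coarseStep) ⊘ param superblock

nearBlockOf : Expr → Expr
nearBlockOf i = superblockOf i ⊗ param superblock ⊕ narrow fine (i ⊘ param fineStep)

-- The superblock test comes first because `nearBlockOf` joins the sampled superblock to a remainder
-- modulo Q, which is justified only while i has not passed the end of that superblock.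
blockOf : Expr → Expr
blockOf i =
  ifLt i (wide rankAbs (superblockOf i ⊕ lit 1))
    (ifLt i (rankAt (nearBlockOf i ⊕ lit 1))
      (nearBlockOf i)
      (superblockOf i ⊗ param superblock ⊕
        narrow fineSpan (nearBlockOf i ⊗ param fineStep ⊕ i ⊛ param fineStep)))
    (wide coarseSpan (superblockOf i ⊗ param coarseStep ⊕ i ⊛ param coarseStep))

selectExpr : Expr
selectExpr = k ⊗ param blockSize ⊕ inTable selectTable k (i ⊖ rankAt k)
  where
  -- The select query counts from 1, all tables from 0.
  i = input ⊖ lit 1
  k = blockOf i

-- The representation

module Representation (w ρ b Q K₂ d n : ℕ)
  .{{_ : NonZero b}} .{{_ : NonZero Q}} .{{_ : NonZero K₂}} .{{_ : NonZero (d * K₂)}}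
  (σ : ℕ → Bool) where

  open Blocks b σ public

  -- One more than the number of complete blocks, so n < N * b; if b divides n, the last block is
  -- all padding.
  N : ℕ
  N = suc (n / b)

  open BlockSearch R refl R-mono N Q K₂ d public

  private instance
    2^b≢0 : NonZero (2 ^ b)
    2^b≢0 = m^n≢0 2 b

  count : ℕ → ℕ
  count header      = 18
  -- Select looks up the end of superblock q, which is entry q + 1, for q up to N / Q.
  count rankAbs     = 2 + N / Q
  count rankRel     = 1 + N
  count pointerAbs  = 2 + N / Q
  count pointerRel  = 1 + N
  count coarse      = 1 + n / K₁
  count coarseSpan  = (1 + N / Q) * K₁
  count fine        = 1 + n / K₂
  count fineSpan    = N * K₂
  count rankTable   = suc b * 2 ^ b * b
  count selectTable = suc b * 2 ^ b * b
  count _           = N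

  width : ℕ → ℕ → ℕ
  width header      _ = w
  width rankAbs     _ = w
  width rankRel     _ = ρ
  width pointerAbs  _ = w
  width pointerRel  _ = ρ
  width coarse      _ = w
  width coarseSpan  _ = w
  width fine        _ = ρ
  width fineSpan    _ = ρ
  width rankTable   _ = ρ
  width selectTable _ = ρ
  width _             = blockLength

  sectionSize : ℕ → ℕ
  sectionSize a = sum< (width a) (count a)

  parameter : ℕ → ℕ
  parameter narrowWidth = ρ
  parameter blockSize   = b
  parameter superblock  = Q
  parameter coarseStep  = K₁
  parameter fineStep    = K₂
  parameter tableRow    = 2 ^ b
  parameter a           = sum< sectionSize a

  -- Each number of ones gets 2 ^ b rows, whatever the size of its class, so that an address is a
  -- plain product; rows that belong to no code hold the answers for the default word of `decode`.
  tableIndex : ℕ → ℕ → ℕ → ℕ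
  tableIndex c o p = (c * 2 ^ b + o) * b + p

  tableBlock : ℕ → ℕ → Bool
  tableBlock x = bit (decode b (x / b / 2 ^ b) (x / b % 2 ^ b))

  -- coarseSpan lists the group of K₁ ones that straddles the end of superblock
  -- x / K₁, fineSpan the group of K₂ ones that straddles the end of block x / K₂.
  entry : ℕ → ℕ → ℕ
  entry header        = parameter
  entry rankAbs     q = R (q * Q)
  entry rankRel     k = R k ∸ R (k / Q * Q)
  entry pointerAbs  q = pointer (q * Q)
  entry pointerRel  k = pointer k ∸ pointer (k / Q * Q)
  entry coarse      j = find (j * K₁)
  entry coarseSpan  x = find (R ((x / K₁ + 1) * Q) / K₁ * K₁ + x % K₁)
  entry fine        j = find (j * K₂) % Q
  entry fineSpan    x = find (R (x / K₂ + 1) / K₂ * K₂ + x % K₂) % Q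
  entry rankTable   x = ones (tableBlock x) (suc (x % b))
  entry selectTable x = locate (ones (tableBlock x)) b (x % b)
  entry _           k = code (block k)

  section : ℕ → List Bool
  section a = array (width a) (entry a) (count a)

  representation : List Bool
  representation = concat< section 12

  length-representation : length representation ≡ sum< sectionSize 12
  length-representation = trans (length-concat< section 12)
    (sum<-cong 12 λ a _ → length-array (width a) (entry a) (count a))

  Field-entry : ∀ a {i} → a < 12 → i < count a →
    Field representation (sum< sectionSize a + sum< (width a) i) (width a i) (entry a i)
  Field-entry a {i} a<12 i<count =
    subst (λ s → Field representation (s + sum< (width a) i) (width a i) (entry a i))
      (sum<-cong a λ a′ _ → length-array (width a′) (entry a′) (count a′))
      (Field-concat< section 12 a<12 (Field-array (width a) (entry a) i<count))

  -- What the queries need from the sizes, which are still free here. The last field covers relative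
  -- ranks and pointers: over Q blocks they grow by at most b + 1 per block, since a code may take b
  -- + 1 bits.
  record Fits : Set where
    field
      ones≤n        : ∀ i → ones σ i ≤ n
      1+n<2^w       : suc n < 2 ^ w
      N<2^w         : N < 2 ^ w
      K₁<2^w        : K₁ < 2 ^ w
      length<2^w    : length representation < 2 ^ w
      1≤ρ           : 1 ≤ ρ
      ρ≤w           : ρ ≤ w
      b<w           : b < w
      Q*[1+b]<2^ρ   : Q * suc b < 2 ^ ρ

  -- Evaluation of the queries on the stored sections

  module Correctness (fits : Fits) (μ : Memory) (stored : Stores μ representation) (x : ℕ) where

    open Fits fits
    open Evaluation w μ x

    1≤w : 1 ≤ w
    1≤w = ≤-trans 1≤ρ ρ≤w

    2^ρ≤2^w : 2 ^ ρ ≤ 2 ^ w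
    2^ρ≤2^w = ^-monoʳ-≤ 2 ρ≤w

    Q<2^ρ : Q < 2 ^ ρ
    Q<2^ρ = ≤-<-trans (m≤m*n Q (suc b)) Q*[1+b]<2^ρ

    b<2^ρ : b < 2 ^ ρ
    b<2^ρ = <-trans (n<1+n b) (≤-<-trans (m≤n*m (suc b) Q) Q*[1+b]<2^ρ)

    module _ (a : ℕ) {a<12 : T (a <ᵇ 12)} where

      -- Together with `length<2^w` this bounds every address that is read, and with it all terms
      -- from which the address is computed.
      inside : ∀ {i} → i < count a →
        (sum< sectionSize a + sum< (width a) i) + width a i ≤ length representation
      inside i<count = Field.inside (Field-entry a (<ᵇ⇒< a 12 a<12) i<count)

      start<2^w : sum< sectionSize a < 2 ^ w
      start<2^w = ≤-<-trans (sum<-mono-≤ sectionSize (<⇒≤ (<ᵇ⇒< a 12 a<12)))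
        (subst (_< 2 ^ w) length-representation length<2^w)

      read-entry : ∀ {i e₁ e₂} → i < count a → width a i ≤ w → entry a i < 2 ^ width a i →
        e₁ ⇓ sum< sectionSize a + sum< (width a) i → e₂ ⇓ width a i → read e₁ e₂ ⇓ entry a i
      read-entry i<count ≤w v< E₁ E₂ =
        read E₁ E₂ ≤w v< (Stores-Field {μ} stored (Field-entry a (<ᵇ⇒< a 12 a<12) i<count))

    param⇓ : ∀ a {a<18 : T (a <ᵇ 18)} → parameter a < 2 ^ w → param a ⇓ parameter a
    param⇓ a {a<18} <2^w = read-entry header {i = a} a<count ≤-refl <2^w
      (subst (lit a ⊗ wordSize ⇓_) (sym (sum<-const w a))
        (bin (lit (≤-<-trans (m≤m*n a w {{>-nonZero 1≤w}}) a*w<2^w)) wordSize mul a*w<2^w))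
      wordSize
      where
      a<count = <ᵇ⇒< a 18 a<18
      a*w<2^w : a * w < 2 ^ w
      a*w<2^w = ≤-<-trans
        (≤-trans (≤-reflexive (sym (sum<-const w a))) (≤-trans (m≤m+n _ w) (inside header {i = a} a<count)))
        length<2^w

    element⇓ : ∀ a {a<12 : T (a <ᵇ 12)} {a<18 : T (a <ᵇ 18)} {i eᵢ eₗ ℓ} →
      parameter a ≡ sum< sectionSize a → (∀ i → width a i ≡ ℓ) → 1 ≤ ℓ → ℓ ≤ w → eₗ ⇓ ℓ →
      eᵢ ⇓ i → i < count a → entry a i < 2 ^ ℓ → element eₗ a eᵢ ⇓ entry a i
    element⇓ a {a<12} {a<18} {i} {eᵢ} {eₗ} {ℓ} start width≡ 1≤ℓ ℓ≤w Eₗ Eᵢ i<count <2^ℓ =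
      read-entry a {a<12} i<count (subst (_≤ w) (sym (width≡ i)) ℓ≤w)
        (subst (λ ℓ → entry a i < 2 ^ ℓ) (sym (width≡ i)) <2^ℓ)
        (subst (param a ⊕ eᵢ ⊗ eₗ ⇓_) (cong₂ _+_ start (sym offset≡)) (bin start⇓ (bin Eᵢ Eₗ mul offset<) add address<))
        (subst (eₗ ⇓_) (sym (width≡ i)) Eₗ)
      where
      offset≡ : sum< (width a) i ≡ i * ℓ
      offset≡ = trans (sum<-cong i λ j _ → width≡ j) (sum<-const ℓ i)
      address< : parameter a + i * ℓ < 2 ^ w
      address< = ≤-<-trans (≤-trans (≤-reflexive (sym (cong₂ _+_ (sym start) offset≡)))
        (≤-trans (m≤m+n _ _) (inside a {a<12} i<count))) length<2^w
      offset< : i * ℓ < 2 ^ w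
      offset< = ≤-<-trans (m≤n+m _ (parameter a)) address<
      start⇓ : param a ⇓ parameter a
      start⇓ = param⇓ a {a<18} (≤-<-trans (m≤m+n _ (i * ℓ)) address<)

    -- Entries have positive width, so an index is at most its own bit offset, which lies in the
    -- representation.
    position<2^w : ∀ a {a<12 : T (a <ᵇ 12)} {i ℓ} → (∀ i → width a i ≡ ℓ) → 1 ≤ ℓ → i < count a → i < 2 ^ w
    position<2^w a {a<12} {i} {ℓ} width≡ 1≤ℓ i<count = begin-strict
      i                                           ≤⟨ m≤m*n i ℓ {{>-nonZero 1≤ℓ}} ⟩
      i * ℓ                                       ≡⟨ sum<-const ℓ i ⟨
      sum< (λ _ → ℓ) i                            ≡⟨ sum<-cong i (λ j _ → width≡ j) ⟨
      sum< (width a) i                            ≤⟨ m≤n+m _ (sum< sectionSize a) ⟩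
      sum< sectionSize a + sum< (width a) i       ≤⟨ m≤m+n _ (width a i) ⟩
      sum< sectionSize a + sum< (width a) i + width a i  ≤⟨ inside a {a<12} i<count ⟩
      length representation                       <⟨ length<2^w ⟩
      2 ^ w                                       ∎
      where open ≤-Reasoning

    wide⇓ : ∀ a {a<12 : T (a <ᵇ 12)} {a<18 : T (a <ᵇ 18)} {i e} →
      parameter a ≡ sum< sectionSize a → (∀ i → width a i ≡ w) →
      e ⇓ i → i < count a → entry a i < 2 ^ w → wide a e ⇓ entry a i
    wide⇓ a {a<12} {a<18} start width≡ = element⇓ a {a<12} {a<18} start width≡ 1≤w ≤-refl wordSize

    narrow⇓ : ∀ a {a<12 : T (a <ᵇ 12)} {a<18 : T (a <ᵇ 18)} {i e} →
      parameter a ≡ sum< sectionSize a → (∀ i → width a i ≡ ρ) →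
      e ⇓ i → i < count a → entry a i < 2 ^ ρ → narrow a e ⇓ entry a i
    narrow⇓ a {a<12} {a<18} start width≡ = element⇓ a {a<12} {a<18} start width≡ 1≤ρ ρ≤w
      (param⇓ narrowWidth (<-≤-trans (n<2^n ρ) 2^ρ≤2^w))

    superblock⇓ : param superblock ⇓ Q
    superblock⇓ = param⇓ superblock (<-≤-trans Q<2^ρ 2^ρ≤2^w)

    blockSize⇓ : param blockSize ⇓ b
    blockSize⇓ = param⇓ blockSize (<-trans b<w (n<2^n w))

    R<2^w : ∀ k → R k < 2 ^ w
    R<2^w k = ≤-<-trans (ones≤n (k * b)) (<-trans (n<1+n n) 1+n<2^w)

    pointer<2^w : ∀ {k} → k ≤ N → pointer k < 2 ^ w
    pointer<2^w {k} k≤N = begin-strict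
      pointer k                               ≤⟨ sum<-mono-≤ blockLength k≤N ⟩
      sectionSize codes                       ≤⟨ m≤n+m _ (sum< sectionSize 11) ⟩
      sum< sectionSize 11 + sectionSize codes ≡⟨ sum<-suc sectionSize 11 ⟨
      sum< sectionSize 12                     ≡⟨ length-representation ⟨
      length representation                   <⟨ length<2^w ⟩
      2 ^ w                                   ∎
      where open ≤-Reasoning

    R-+ : ∀ k r → R (k + r) ≤ R k + r * suc b
    R-+ k r = begin
      ones σ ((k + r) * b)                          ≡⟨ cong (ones σ) (*-distribʳ-+ b k r) ⟩
      ones σ (k * b + r * b)                        ≡⟨ sum<-+ _ (k * b) (r * b) ⟩
      R k + ones (λ j → σ (k * b + j)) (r * b)      ≤⟨ +-monoʳ-≤ (R k) (ones-≤ _ (r * b)) ⟩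
      R k + r * b                                   ≤⟨ +-monoʳ-≤ (R k) (*-monoʳ-≤ r (n≤1+n b)) ⟩
      R k + r * suc b                               ∎
      where open ≤-Reasoning

    pointer-+ : ∀ k r → pointer (k + r) ≤ pointer k + r * suc b
    pointer-+ k r = ≤-trans (≤-reflexive (sum<-+ blockLength k r))
      (+-monoʳ-≤ (pointer k) (sum<-≤ r λ j _ → codeLength-≤ b (size (block (k + j)))))

    relative< : ∀ (f : ℕ → ℕ) → (∀ k r → f (k + r) ≤ f k + r * suc b) → ∀ k → f k ∸ f (k / Q * Q) < 2 ^ ρ
    relative< f f-+ k = begin-strict
      f k ∸ f (k / Q * Q)                  ≡⟨ cong (λ j → f j ∸ f (k / Q * Q)) (/*+% k Q) ⟨
      f (k / Q * Q + k % Q) ∸ f (k / Q * Q)  ≤⟨ m≤n+o⇒m∸n≤o _ (f (k / Q * Q)) (f-+ (k / Q * Q) (k % Q)) ⟩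
      k % Q * suc b                        ≤⟨ *-monoˡ-≤ (suc b) (m%n≤n k Q) ⟩
      Q * suc b                            <⟨ Q*[1+b]<2^ρ ⟩
      2 ^ ρ                                ∎
      where open ≤-Reasoning

    k/Q⇓ : ∀ {e k} → e ⇓ k → k ≤ N → e ⊘ param superblock ⇓ k / Q
    k/Q⇓ {k = k} E k≤N = bin E superblock⇓ div (≤-<-trans (≤-trans (m/n≤m k Q) k≤N) N<2^w)

    k/Q<count : ∀ {k} → k ≤ N → k / Q < 2 + N / Q
    k/Q<count k≤N = ≤-trans (s≤s (/-monoˡ-≤ Q k≤N)) (n≤1+n _)

    rankAt⇓ : ∀ {e k} → e ⇓ k → k ≤ N → rankAt e ⇓ R k
    rankAt⇓ {e} {k} E k≤N = subst (rankAt e ⇓_) split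
      (bin (wide⇓ rankAbs refl (λ _ → refl) (k/Q⇓ E k≤N) (k/Q<count k≤N) (R<2^w (k / Q * Q)))
           (narrow⇓ rankRel refl (λ _ → refl) E (s≤s k≤N) (relative< R R-+ k))
           add (subst (_< 2 ^ w) (sym split) (R<2^w k)))
      where
      split : R (k / Q * Q) + (R k ∸ R (k / Q * Q)) ≡ R k
      split = m+[n∸m]≡n (R-mono (m/n*n≤m k Q))

    pointerAt⇓ : ∀ {e k} → e ⇓ k → k ≤ N → pointerAt e ⇓ pointer k
    pointerAt⇓ {e} {k} E k≤N = subst (pointerAt e ⇓_) split
      (bin (wide⇓ pointerAbs refl (λ _ → refl) (k/Q⇓ E k≤N) (k/Q<count k≤N)
              (pointer<2^w (≤-trans (m/n*n≤m k Q) k≤N)))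
           (narrow⇓ pointerRel refl (λ _ → refl) E (s≤s k≤N) (relative< pointer pointer-+ k))
           add (subst (_< 2 ^ w) (sym split) (pointer<2^w k≤N)))
      where
      split : pointer (k / Q * Q) + (pointer k ∸ pointer (k / Q * Q)) ≡ pointer k
      split = m+[n∸m]≡n (sum<-mono-≤ blockLength (m/n*n≤m k Q))

    module _ {e k} (E : e ⇓ k) (k<N : k < N) where

      private
        c = size (block k)
        o = code (block k)
        key = c * 2 ^ b + o

      k+1≤N : k + 1 ≤ N
      k+1≤N = subst (_≤ N) (+-comm 1 k) k<N

      k+1⇓ : e ⊕ lit 1 ⇓ k + 1
      k+1⇓ = bin E (lit (≤-<-trans 1≤w (n<2^n w))) add (≤-<-trans k+1≤N N<2^w)

      c≤b : c ≤ b
      c≤b = ones-≤ (bit (block k)) b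

      o<2^b : o < 2 ^ b
      o<2^b = <-≤-trans (code<∣class∣ (block k)) (∣class∣≤2^b b c)

      size⇓ : rankAt (e ⊕ lit 1) ⊖ rankAt e ⇓ c
      size⇓ = subst (rankAt (e ⊕ lit 1) ⊖ rankAt e ⇓_)
        (trans (cong (_∸ R k) (R-suc k)) (m+n∸m≡n (R k) c))
        (bin (rankAt⇓ k+1⇓ k+1≤N) (rankAt⇓ E (<⇒≤ k<N)) (sub (R-mono (m≤m+n k 1)))
          (≤-<-trans (m∸n≤m _ (R k)) (R<2^w (k + 1))))

      length⇓ : pointerAt (e ⊕ lit 1) ⊖ pointerAt e ⇓ blockLength k
      length⇓ = subst (pointerAt (e ⊕ lit 1) ⊖ pointerAt e ⇓_)
        (trans (cong (_∸ pointer k) (trans (cong pointer (+-comm k 1)) (sum<-suc blockLength k)))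
               (m+n∸m≡n (pointer k) (blockLength k)))
        (bin (pointerAt⇓ k+1⇓ k+1≤N) (pointerAt⇓ E (<⇒≤ k<N)) (sub (sum<-mono-≤ blockLength (m≤m+n k 1)))
          (≤-<-trans (m∸n≤m _ (pointer k)) (pointer<2^w k+1≤N)))

      code⇓ : read (param codes ⊕ pointerAt e) (pointerAt (e ⊕ lit 1) ⊖ pointerAt e) ⇓ o
      code⇓ = read-entry codes k<N (≤-trans (codeLength-≤ b c) b<w) (code<2^codeLength (block k))
        (bin (param⇓ codes (start<2^w codes)) (pointerAt⇓ E (<⇒≤ k<N)) add
          (≤-<-trans (≤-trans (m≤m+n _ _) (inside codes k<N)) length<2^w))
        length⇓

      module _ {eₚ p} (Eₚ : eₚ ⇓ p) (p<b : p < b) where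

        slot : ℕ
        slot = tableIndex c o p

        slot<count : slot < suc b * 2 ^ b * b
        slot<count = begin-strict
          key * b + p   <⟨ +-monoʳ-< _ p<b ⟩
          key * b + b   ≡⟨ +-comm _ b ⟩
          suc key * b   ≤⟨ *-monoˡ-≤ b (+-monoʳ-< (c * 2 ^ b) o<2^b) ⟩
          (c * 2 ^ b + 2 ^ b) * b   ≡⟨ cong (_* b) (+-comm (c * 2 ^ b) (2 ^ b)) ⟩
          suc c * 2 ^ b * b         ≤⟨ *-monoˡ-≤ b (*-monoˡ-≤ (2 ^ b) (s≤s c≤b)) ⟩
          suc b * 2 ^ b * b         ∎
          where open ≤-Reasoning

        table-block : tableBlock slot ≡ bit (block k)
        table-block = cong bit (trans
          (cong₂ (decode b)
            (trans (cong (_/ 2 ^ b) (/-unique key b p<b)) (/-unique c (2 ^ b) o<2^b))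
            (trans (cong (_% 2 ^ b) (/-unique key b p<b)) (%-unique c (2 ^ b) o<2^b)))
          (decode-code (block k)))

        inTable⇓ : ∀ t {t<12 : T (t <ᵇ 12)} {t<18 : T (t <ᵇ 18)} →
          parameter t ≡ sum< sectionSize t → (∀ i → width t i ≡ ρ) → count t ≡ suc b * 2 ^ b * b →
          (entry t slot ≤ b) → inTable t e eₚ ⇓ entry t slot
        inTable⇓ t {t<12} {t<18} start width≡ count≡ ≤b =
          narrow⇓ t {t<12} {t<18} start width≡ slot⇓ i<count (≤-<-trans ≤b b<2^ρ)
          where
          i<count : slot < count t
          i<count = subst (slot <_) (sym count≡) slot<count
          slot<2^w = position<2^w t {t<12} width≡ 1≤ρ i<count
          key*b<2^w = ≤-<-trans (m≤m+n _ p) slot<2^w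
          key<2^w = ≤-<-trans (m≤m*n key b) key*b<2^w
          slot⇓ = bin (bin (bin (bin size⇓ (param⇓ tableRow (^-monoʳ-< 2 (s≤s z<s) b<w)) mul
              (≤-<-trans (m≤m+n _ o) key<2^w)) code⇓ add key<2^w) blockSize⇓ mul key*b<2^w) Eₚ add slot<2^w

        rank-in-block⇓ : inTable rankTable e eₚ ⇓ ones (bit (block k)) (suc p)
        rank-in-block⇓ = subst (inTable rankTable e eₚ ⇓_) value≡
          (inTable⇓ rankTable refl (λ _ → refl) refl
            (subst (_≤ b) (sym value≡) (≤-trans (ones-≤ (bit (block k)) (suc p)) p<b)))
          where
          value≡ : entry rankTable slot ≡ ones (bit (block k)) (suc p)
          value≡ = cong₂ (λ τ j → ones τ (suc j)) table-block (%-unique key b p<b)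

        select-in-block⇓ : inTable selectTable e eₚ ⇓ locate (ones (bit (block k))) b p
        select-in-block⇓ = subst (inTable selectTable e eₚ ⇓_) value≡
          (inTable⇓ selectTable refl (λ _ → refl) refl
            (locate-≤ (ones (tableBlock slot)) b (slot % b)))
          where
          value≡ : entry selectTable slot ≡ locate (ones (bit (block k))) b p
          value≡ = cong₂ (λ τ j → locate (ones τ) b j) table-block (%-unique key b p<b)

    x/b<N : ∀ {y} → y < n → y / b < N
    x/b<N y<n = s≤s (/-monoˡ-≤ b (<⇒≤ y<n))

    rank⇓ : x < n → rankExpr ⇓ ones σ (suc x)
    rank⇓ x<n = subst (rankExpr ⇓_) split
      (bin (rankAt⇓ k⇓ (<⇒≤ k<N)) (rank-in-block⇓ k⇓ k<N p⇓ p<b) add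
        (subst (_< 2 ^ w) (sym split) (≤-<-trans (ones≤n (suc x)) (<-trans (n<1+n n) 1+n<2^w))))
      where
      k = x / b
      p = x % b
      x<2^w : x < 2 ^ w
      x<2^w = <-trans x<n (<-trans (n<1+n n) 1+n<2^w)
      k<N = x/b<N x<n
      p<b = m%n<n x b
      k⇓ = bin input blockSize⇓ div (≤-<-trans (m/n≤m x b) x<2^w)
      p⇓ = bin input blockSize⇓ mod (≤-<-trans (m%n≤m x b) x<2^w)
      split : R k + ones (bit (block k)) (suc p) ≡ ones σ (suc x)
      split = trans (sym (ones-block k p<b))
        (cong (ones σ) (trans (+-suc (k * b) p) (cong suc (/*+% x b))))

    find<N : ∀ {i} → i < R N → find i < N
    find<N i<R = proj₁ (find-correct i<R)

    K₂≤K₁ : K₂ ≤ K₁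
    K₂≤K₁ = m≤n*m K₂ d {{m*n≢0⇒m≢0 d}}

    module _ {e i} (E : e ⇓ i) (i<R : i < R N) where

      private
        i₁ = i / K₁ * K₁
        i₂ = i / K₂ * K₂
        q  = find i₁ / Q
        k₂ = find i₂
        bd = R ((q + 1) * Q)
        i₁<R = ≤-<-trans (m/n*n≤m i K₁) i<R
        i₂<R = ≤-<-trans (m/n*n≤m i K₂) i<R
        i<n : i < n
        i<n = <-≤-trans i<R (ones≤n (N * b))
        i<2^w = <-trans i<n (<-trans (n<1+n n) 1+n<2^w)
        find<2^w : ∀ j → find j < 2 ^ w
        find<2^w j = ≤-<-trans (locate-≤ R N j) N<2^w
        coarseStep⇓ = param⇓ coarseStep K₁<2^w
        fineStep⇓   = param⇓ fineStep (≤-<-trans K₂≤K₁ K₁<2^w)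

        q⇓ = bin (wide⇓ coarse refl (λ _ → refl)
                   (bin E coarseStep⇓ div (≤-<-trans (m/n≤m i K₁) i<2^w))
                   (s≤s (/-monoˡ-≤ K₁ (<⇒≤ i<n))) (find<2^w i₁))
                 superblock⇓ div (≤-<-trans (m/n≤m (find i₁) Q) (find<2^w i₁))

        q≤N/Q : q ≤ N / Q
        q≤N/Q = /-monoˡ-≤ Q (<⇒≤ (find<N i₁<R))

        q+1≤count : q + 1 ≤ 1 + N / Q
        q+1≤count = subst (_≤ 1 + N / Q) (+-comm 1 q) (s≤s q≤N/Q)

        bd⇓ = wide⇓ rankAbs refl (λ _ → refl)
          (bin q⇓ (lit (≤-<-trans 1≤w (n<2^n w))) add
            (≤-<-trans (≤-trans (≤-reflexive (+-comm q 1)) (≤-<-trans (m/n≤m (find i₁) Q) (find<N i₁<R))) N<2^w))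
          (s≤s q+1≤count) (R<2^w ((q + 1) * Q))

        module _ (i<bd : i < bd) where

          from-q : ∀ {f j} → f ⇓ find j % Q → i₁ ≤ j → j ≤ i →
                   superblockOf e ⊗ param superblock ⊕ f ⇓ find j
          from-q {j = j} F i₁≤j j≤i = subst (_ ⇓_) (near i<R i<bd i₁≤j j≤i)
            (bin (bin q⇓ superblock⇓ mul (≤-<-trans (m≤m+n _ (find j % Q)) sum<2^w)) F add sum<2^w)
            where
            sum<2^w : q * Q + find j % Q < 2 ^ w
            sum<2^w = subst (_< 2 ^ w) (sym (near i<R i<bd i₁≤j j≤i)) (find<2^w j)

          k₂⇓ = from-q (narrow⇓ fine refl (λ _ → refl)
              (bin E fineStep⇓ div (≤-<-trans (m/n≤m i K₂) i<2^w))
              (s≤s (/-monoˡ-≤ K₂ (<⇒≤ i<n))) (<-trans (m%n<n (find i₂) Q) Q<2^ρ))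
            (i₁≤i₂ i<R) (i₂≤i i<R)

          k₂+1≤N : k₂ + 1 ≤ N
          k₂+1≤N = subst (_≤ N) (+-comm 1 k₂) (find<N i₂<R)

          R₂⇓ = rankAt⇓ (bin k₂⇓ (lit (≤-<-trans 1≤w (n<2^n w))) add (≤-<-trans k₂+1≤N N<2^w)) k₂+1≤N

          later⇓ : R (k₂ + 1) ≤ i → _ ⇓ find i
          later⇓ R₂≤i = from-q (subst (_ ⇓_) value≡
              (narrow⇓ fineSpan refl (λ _ → refl) position⇓ position<
                (<-trans (m%n<n (find (R (position / K₂ + 1) / K₂ * K₂ + position % K₂)) Q) Q<2^ρ)))
            (m/n*n≤m i K₁) ≤-refl
            where
            r = i % K₂
            r<K₂ = m%n<n i K₂
            position = k₂ * K₂ + r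
            position< : position < N * K₂
            position< = begin-strict
              k₂ * K₂ + r    <⟨ +-monoʳ-< (k₂ * K₂) r<K₂ ⟩
              k₂ * K₂ + K₂   ≡⟨ +-comm (k₂ * K₂) K₂ ⟩
              suc k₂ * K₂    ≤⟨ *-monoˡ-≤ K₂ (find<N i₂<R) ⟩
              N * K₂         ∎
              where open ≤-Reasoning
            position<2^w′ = position<2^w fineSpan (λ _ → refl) 1≤ρ position<
            position⇓ = bin (bin k₂⇓ fineStep⇓ mul (≤-<-trans (m≤m+n _ r) position<2^w′))
              (bin E fineStep⇓ mod (≤-<-trans (m%n≤m i K₂) i<2^w)) add position<2^w′
            value≡ : entry fineSpan position ≡ find i % Q
            value≡ = cong (_% Q) (trans
              (cong₂ (λ k r → find (R (k + 1) / K₂ * K₂ + r)) (/-unique k₂ K₂ r<K₂) (%-unique k₂ K₂ r<K₂))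
              (later i<R R₂≤i))

        far⇓ : bd ≤ i → _ ⇓ find i
        far⇓ bd≤i = subst (_ ⇓_) value≡
            (wide⇓ coarseSpan refl (λ _ → refl) position⇓ position<
              (find<2^w (R ((position / K₁ + 1) * Q) / K₁ * K₁ + position % K₁)))
          where
          r = i % K₁
          r<K₁ = m%n<n i K₁
          position = q * K₁ + r
          position< : position < (1 + N / Q) * K₁
          position< = begin-strict
            q * K₁ + r     <⟨ +-monoʳ-< (q * K₁) r<K₁ ⟩
            q * K₁ + K₁    ≡⟨ +-comm (q * K₁) K₁ ⟩
            suc q * K₁     ≤⟨ *-monoˡ-≤ K₁ (s≤s q≤N/Q) ⟩
            (1 + N / Q) * K₁ ∎
            where open ≤-Reasoning
          position<2^w′ = position<2^w coarseSpan (λ _ → refl) 1≤w position<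
          position⇓ = bin (bin q⇓ coarseStep⇓ mul (≤-<-trans (m≤m+n _ r) position<2^w′))
            (bin E coarseStep⇓ mod (≤-<-trans (m%n≤m i K₁) i<2^w)) add position<2^w′
          value≡ : entry coarseSpan position ≡ find i
          value≡ = trans
            (cong₂ (λ k r → find (R ((k + 1) * Q) / K₁ * K₁ + r)) (/-unique q K₁ r<K₁) (%-unique q K₁ r<K₁))
            (far i<R bd≤i)

      blockOf⇓ : blockOf e ⇓ find i
      blockOf⇓ with i <? bd
      ... | no i≮bd = ifFalse E bd⇓ (≮⇒≥ i≮bd) (far⇓ (≮⇒≥ i≮bd))
      ... | yes i<bd with i <? R (k₂ + 1)
      ...   | yes i<R₂ = ifTrue E bd⇓ i<bd (ifTrue E (R₂⇓ i<bd) i<R₂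
                           (subst (_ ⇓_) (within i<R i<R₂) (k₂⇓ i<bd)))
      ...   | no  i≮R₂ = ifTrue E bd⇓ i<bd (ifFalse E (R₂⇓ i<bd) (≮⇒≥ i≮R₂) (later⇓ i<bd (≮⇒≥ i≮R₂)))

    select⇓ : ∀ {y} → x ≡ suc (ones σ y) → y < n → σ y ≡ true → selectExpr ⇓ y
    select⇓ {y} refl y<n σy = subst (selectExpr ⇓_) found
      (bin (bin k⇓ blockSize⇓ mul (≤-<-trans (m≤m+n _ p) result<2^w))
        (select-in-block⇓ k⇓ k<N (bin i⇓ (rankAt⇓ k⇓ (<⇒≤ k<N)) (sub lo) (≤-<-trans (m∸n≤m i (R k)) i<2^w))
          (<-≤-trans r<size (ones-≤ (bit (block k)) b)))
        add result<2^w)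
      where
      i = ones σ y
      ones-suc : ones σ (suc y) ≡ suc i
      ones-suc = trans (sum<-suc _ y) (trans (cong (λ c → i + [ c ]₁) σy) (+-comm i 1))
      i<ones-suc : i < ones σ (suc y)
      i<ones-suc = ≤-reflexive (sym ones-suc)
      i<R : i < R N
      i<R = <-≤-trans i<ones-suc (sum<-mono-≤ _ (≤-trans y<n
        (<⇒≤ (subst (λ j → n < j * b) (+-comm (n / b) 1) (m<[1+m/K]*K n b)))))
      i<2^w : i < 2 ^ w
      i<2^w = ≤-<-trans (ones≤n y) (<-trans (n<1+n n) 1+n<2^w)
      i⇓ : input ⊖ lit 1 ⇓ i
      i⇓ = bin input (lit (≤-<-trans 1≤w (n<2^n w))) (sub (s≤s z≤n)) i<2^w
      k = find i
      k<N : k < N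
      k<N = find<N i<R
      k⇓ : blockOf (input ⊖ lit 1) ⇓ k
      k⇓ = blockOf⇓ i⇓ i<R
      lo : R k ≤ i
      lo = proj₁ (proj₂ (find-correct i<R))
      r = i ∸ R k
      p = locate (ones (bit (block k))) b r
      R+r≡i : R k + r ≡ i
      R+r≡i = m+[n∸m]≡n lo
      r<size : r < size (block k)
      r<size = +-cancelˡ-< (R k) _ _ (subst₂ _<_ (sym R+r≡i) (R-suc k) (proj₂ (proj₂ (find-correct i<R))))
      p-correct = locate-correct (ones (bit (block k))) b z≤n r<size
      p<b = proj₁ p-correct
      ones-mono : ∀ {i j} → i ≤ j → ones σ i ≤ ones σ j
      ones-mono = sum<-mono-≤ _
      found : k * b + p ≡ y
      -- Both positions have at most i ones before them and more than i ones up to and including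
      -- them.
      found = bracket-unique (ones σ) ones-mono {i = i}
        (begin
          ones σ (k * b + p)                 ≡⟨ ones-block k (<⇒≤ p<b) ⟩
          R k + ones (bit (block k)) p       ≤⟨ +-monoʳ-≤ (R k) (proj₁ (proj₂ p-correct)) ⟩
          R k + r                            ≡⟨ R+r≡i ⟩
          i                                  ∎)
        (begin-strict
          i                                  ≡⟨ R+r≡i ⟨
          R k + r                            <⟨ +-monoʳ-< (R k) (proj₂ (proj₂ p-correct)) ⟩
          R k + ones (bit (block k)) (suc p) ≡⟨ ones-block k p<b ⟨
          ones σ (k * b + suc p)             ≡⟨ cong (ones σ) (+-suc (k * b) p) ⟩
          ones σ (suc (k * b + p))           ∎)
        ≤-refl i<ones-suc
        where open ≤-Reasoning
      result<2^w : k * b + p < 2 ^ w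
      result<2^w = subst (_< 2 ^ w) (sym found) (<-trans y<n (<-trans (n<1+n n) 1+n<2^w))

-- Evaluation takes place from register 1 upwards, because register 0 has to keep the input until
-- the end.
answer : ∀ k → Expr → Program (suc k)
answer k e = compile k e 1 ⨾ instr (move zero (reg k 1))

answer-correct : ∀ {w k e D x y} → x < 2 ^ w → suc (depth e) ≤ k →
  (∀ μ → Stores μ D → Evaluation._⇓_ w μ x e y) → Answers w (answer k e) D (cost e + 1) x y
answer-correct {w} {k} {e} {D} {x} {y} x<2^w room E μ stored = finish final run result
  where
  open Evaluation w μ x
  open Computes (compile-correct (E μ stored) 1 ≤-refl room (word w x ∷ replicate k (word w 0))
                   (value-word w x<2^w))
  finish : ∀ f → compile k e 1 , (word w x ∷ replicate k (word w 0) , μ) ⇓[ time ] (f , μ) →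
    value (lookup f (reg k 1)) ≡ y →
    ∃[ t ] ∃[ r ] ∃[ ρ ] ∃[ μ′ ]
      ((answer k e , (word w x ∷ replicate k (word w 0) , μ) ⇓[ t ] (r ∷ ρ , μ′))
      × t ≤ cost e + 1 × value r ≡ y × Stores μ′ D)
  finish (r ∷ rest) run result = _ , lookup (r ∷ rest) (reg k 1) , rest , μ ,
    ⇓seq run ⇓instr , +-monoˡ-≤ 1 time≤T , result , stored

-- Parameters

^-swap : ∀ x m n → (x ^ m) ^ n ≡ x ^ (n * m)
^-swap x m n = trans (^-*-assoc x m n) (cong (x ^_) (*-comm m n))

-- Polynomial bounds reduced to adding exponents. With X = 2 ^ L they show that numbers fit into
-- words; with X = 2 ^ ℓ they show that polynomials in L are at most 2 ^ b.
module Powers (X : ℕ) (2≤X : 2 ≤ X) where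

  instance
    X≢0 : NonZero X
    X≢0 = >-nonZero (<⇒≤ 2≤X)

  infix 4 _≲_
  _≲_ : ℕ → ℕ → Set
  x ≲ i = x ≤ X ^ i

  ≲-* : ∀ {x y i j} → x ≲ i → y ≲ j → x * y ≲ i + j
  ≲-* {i = i} {j} x≲i y≲j = subst (_ ≤_) (sym (^-distribˡ-+-* X i j)) (*-mono-≤ x≲i y≲j)

  ≲-mono : ∀ {x i j} → i ≤ j → x ≲ i → x ≲ j
  ≲-mono i≤j x≲i = ≤-trans x≲i (^-monoʳ-≤ X i≤j)

  ≲1 : ∀ {x} → x ≤ X → x ≲ 1
  ≲1 = subst (_ ≤_) (sym (*-identityʳ X))

  2^≲ : ∀ i → 2 ^ i ≲ i
  2^≲ i = ^-monoˡ-≤ i 2≤X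

  2+≲2 : ∀ {x} → x ≤ X → 2 + x ≲ 2
  2+≲2 x≤X = ≤-trans (+-mono-≤ 2≤X x≤X) (≤-trans (≤-reflexive (cong (X +_) (sym (+-identityʳ X))))
    (≤-trans (*-monoˡ-≤ X 2≤X) (≤-reflexive (cong (X *_) (sym (*-identityʳ X))))))

  ^-mono-<-≲ : ∀ {x i j} → i < j → x ≲ i → x < X ^ j
  ^-mono-<-≲ i<j x≲i = ≤-<-trans x≲i (^-monoʳ-< X 2≤X i<j)


-- Large enough for addresses to fit into a word for every n.
wordsPerLog : ℕ
wordsPerLog = 32

module Parameters (n : ℕ) where

  -- u is about L ^ (1/4), whereas relative positions have only O(ℓ) = O(log u) bits.
  L ℓ s u b Q ρ w : ℕ
  L = suc ⌊log₂ n ⌋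
  ℓ = suc ⌊log₂ L ⌋
  s = ⌊log₂ L ⌋ / 4
  u = 2 ^ s
  b = u * u
  Q = L * L
  ρ = 4 * ℓ
  w = wordsPerLog * L

  instance
    u≢0 : NonZero u
    u≢0 = m^n≢0 2 s
    b≢0 : NonZero b
    b≢0 = m*n≢0 u u
    Q≢0 : NonZero Q
    Q≢0 = _
    L*u≢0 : NonZero (L * u)
    L*u≢0 = m*n≢0 L u

  n<2^L : n < 2 ^ L
  n<2^L = n<2^[1+log] n

  L<2^ℓ : L < 2 ^ ℓ
  L<2^ℓ = n<2^[1+log] L

  b*b≤L : b * b ≤ L
  b*b≤L = begin
    (u * u) * (u * u)    ≡⟨ fourth u ⟩
    u ^ 4                ≡⟨ ^-*-assoc 2 s 4 ⟩
    2 ^ (s * 4)          ≤⟨ ^-monoʳ-≤ 2 (m/n*n≤m ⌊log₂ L ⌋ 4) ⟩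
    2 ^ ⌊log₂ L ⌋        ≤⟨ 2^log≤n L ⟩
    L                    ∎
    where
    open ≤-Reasoning
    fourth : ∀ u → (u * u) * (u * u) ≡ u * (u * (u * (u * 1)))
    fourth = solve-∀

  b≤L : b ≤ L
  b≤L = ≤-trans (m≤m*n b b) b*b≤L

  u≤b : u ≤ b
  u≤b = m≤m*n u u

  u≤L : u ≤ L
  u≤L = ≤-trans u≤b b≤L

  ℓ≤L : ℓ ≤ L
  ℓ≤L = <-≤-trans (n<2^n ⌊log₂ L ⌋) (2^log≤n L)

  module Rep (σ : ℕ → Bool) = Representation w ρ b Q u L n σ

  module Bounds (σ : ℕ → Bool) where

    open Rep σ

    open Powers (2 ^ L) (^-monoʳ-≤ 2 (s≤s {n = ⌊log₂ n ⌋} z≤n))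

    L≲1 : L ≲ 1
    L≲1 = ≲1 (<⇒≤ (n<2^n L))

    b≲1 : b ≲ 1
    b≲1 = ≤-trans b≤L L≲1

    1+L≲1 : suc L ≲ 1
    1+L≲1 = ≲1 (n<2^n L)

    N≤X : N ≤ 2 ^ L
    N≤X = ≤-trans (s≤s (m/n≤m n b)) n<2^L

    2+N≲2 : 2 + N ≲ 2
    2+N≲2 = 2+≲2 N≤X

    1+N≲2 : 1 + N ≲ 2
    1+N≲2 = ≤-trans (n≤1+n _) 2+N≲2

    2+N/Q≲2 : 2 + N / Q ≲ 2
    2+N/Q≲2 = ≤-trans (+-monoʳ-≤ 2 (m/n≤m N Q)) 2+N≲2

    K₁≲2 : K₁ ≲ 2
    K₁≲2 = ≲-* {i = 1} {1} L≲1 (≤-trans u≤L L≲1)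

    1+n/ : ∀ K .{{_ : NonZero K}} → 1 + n / K ≲ 1
    1+n/ K = ≲1 (≤-trans (s≤s (m/n≤m n K)) n<2^L)

    table≲5 : suc b * 2 ^ b * b ≲ 5
    table≲5 = ≲-mono (m≤n+m 3 2) (≲-* {i = 2} {1} (≲-* {i = 1} {1} (≤-trans (s≤s b≤L) 1+L≲1)
      (≲1 (^-monoʳ-≤ 2 b≤L))) b≲1)

    count≲5 : ∀ a → count a ≲ 5
    count≲5 header      = ≤-trans (m≤m+n 18 14) (2^≲ 5)
    count≲5 rankAbs     = ≲-mono (m≤n+m 2 3) 2+N/Q≲2
    count≲5 rankRel     = ≲-mono (m≤n+m 2 3) 1+N≲2
    count≲5 pointerAbs  = ≲-mono (m≤n+m 2 3) 2+N/Q≲2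
    count≲5 pointerRel  = ≲-mono (m≤n+m 2 3) 1+N≲2
    count≲5 coarse      = ≲-mono (m≤n+m 1 4) (1+n/ K₁)
    count≲5 coarseSpan  = ≲-mono (m≤n+m 4 1) (≲-* {i = 2} {2} (≤-trans (n≤1+n _) 2+N/Q≲2) K₁≲2)
    count≲5 fine        = ≲-mono (m≤n+m 1 4) (1+n/ u)
    count≲5 fineSpan    = ≲-mono (m≤n+m 2 3) (≲-* {i = 1} {1} (≲1 N≤X) (≤-trans u≤L L≲1))
    count≲5 rankTable   = table≲5
    count≲5 selectTable = table≲5
    count≲5 (suc (suc (suc (suc (suc (suc (suc (suc (suc (suc (suc _))))))))))) =
      ≲-mono (m≤n+m 1 4) (≲1 N≤X)

    ρ≤w : ρ ≤ w
    ρ≤w = *-mono-≤ (m≤m+n 4 28) ℓ≤L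

    b<w : b < w
    b<w = ≤-<-trans b≤L (subst (L <_) (*-comm L 32) (m<m*n L 32 (s≤s z<s)))

    width≤w : ∀ a i → width a i ≤ w
    width≤w header      i = ≤-refl
    width≤w rankAbs     i = ≤-refl
    width≤w rankRel     i = ρ≤w
    width≤w pointerAbs  i = ≤-refl
    width≤w pointerRel  i = ρ≤w
    width≤w coarse      i = ≤-refl
    width≤w coarseSpan  i = ≤-refl
    width≤w fine        i = ρ≤w
    width≤w fineSpan    i = ρ≤w
    width≤w rankTable   i = ρ≤w
    width≤w selectTable i = ρ≤w
    width≤w (suc (suc (suc (suc (suc (suc (suc (suc (suc (suc (suc _))))))))))) i =
      ≤-trans (codeLength-≤ b (size (block i))) b<w

    w≲6 : w ≲ 6
    w≲6 = ≲-* {i = 5} {1} (2^≲ 5) L≲1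

    sectionSize≲11 : ∀ a → sectionSize a ≲ 11
    sectionSize≲11 a = ≤-trans (sum<-≤ (count a) λ i _ → width≤w a i) (≲-* {i = 5} {6} (count≲5 a) w≲6)

    <2^w : ∀ {x i} → i < 32 → x ≲ i → x < 2 ^ w
    <2^w {x} i<32 x≲i = subst (x <_) (^-swap 2 L 32) (^-mono-<-≲ i<32 x≲i)

    fits : (∀ i → ones σ i ≤ n) → Fits
    fits ones≤n = record
      { ones≤n      = ones≤n
      ; 1+n<2^w     = <2^w {i = 1} (s≤s (s≤s z≤n)) (≲1 n<2^L)
      ; N<2^w       = <2^w {i = 1} (s≤s (s≤s z≤n)) (≲1 N≤X)
      ; K₁<2^w      = <2^w {i = 2} (m≤m+n 3 29) K₁≲2
      -- Exponents of 2 ^ L: 5 for the number of entries, 6 for their width, and 4 for the twelve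
      -- sections.
      ; length<2^w  = subst (_< 2 ^ w) (sym length-representation)
          (<2^w {i = 15} (m≤m+n 16 16) (≤-trans (sum<-≤ 12 λ a _ → sectionSize≲11 a)
            (≲-* {i = 4} {11} (≤-trans (m≤m+n 12 4) (2^≲ 4)) (≤-refl {(2 ^ L) ^ 11}))))
      ; 1≤ρ         = s≤s z≤n
      ; ρ≤w         = ρ≤w
      ; b<w         = b<w
      -- The factors L, L and b + 1 take ℓ bits each; the fourth ℓ in ρ makes the inequality strict.
      ; Q*[1+b]<2^ρ = begin-strict
          L * L * suc b              ≤⟨ *-mono-≤ (*-mono-≤ (<⇒≤ L<2^ℓ) (<⇒≤ L<2^ℓ)) (≤-trans (s≤s b≤L) L<2^ℓ) ⟩
          2 ^ ℓ * 2 ^ ℓ * 2 ^ ℓ      ≡⟨ cube (2 ^ ℓ) ⟩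
          (2 ^ ℓ) ^ 3                ≡⟨ ^-*-assoc 2 ℓ 3 ⟩
          2 ^ (ℓ * 3)                <⟨ ^-monoʳ-< 2 (s≤s z<s) (subst (ℓ * 3 <_) (*-comm ℓ 4) (*-monoʳ-< ℓ (n<1+n 3))) ⟩
          2 ^ ρ                      ∎
      }
      where
      open ≤-Reasoning
      cube : ∀ x → x * x * x ≡ x * (x * (x * 1))
      cube = solve-∀

-- The entropy as a lower real

module EntropyBound where

  open import Data.Integer as ℤ using (+_)
  import Data.Integer.Properties as ℤ
  import Data.Integer.Tactic.RingSolver as ℤ

  module _ (e : ℕ) where

    private
      d = + suc e

    frac-< : ∀ {i j} → i ℤ.< j → mkℚᵘ i e ℚ.< mkℚᵘ j e
    frac-< i<j = *<* (ℤ.*-monoʳ-<-pos d i<j)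

    frac-≤ : ∀ {i j} → i ℤ.≤ j → mkℚᵘ i e ℚ.≤ mkℚᵘ j e
    frac-≤ i≤j = *≤* (ℤ.*-monoʳ-≤-nonNeg d i≤j)

    frac-+ : ∀ i j → mkℚᵘ i e ℚ.+ mkℚᵘ j e ℚ.≃ mkℚᵘ (i ℤ.+ j) e
    frac-+ i j = *≡* (common i j d)
      where
      common : ∀ i j d → (i ℤ.* d ℤ.+ j ℤ.* d) ℤ.* d ≡ (i ℤ.+ j) ℤ.* (d ℤ.* d)
      common = ℤ.solve-∀

    frac-ℕ : ∀ k → mkℚᵘ (+ k) 0 ℚ.≃ mkℚᵘ (+ k ℤ.* d) e
    frac-ℕ k = *≡* (sym (ℤ.*-identityʳ (+ k ℤ.* d)))

    frac-* : ∀ k i → mkℚᵘ (+ k) 0 ℚ.* mkℚᵘ i e ℚ.≃ mkℚᵘ (+ k ℤ.* i) e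
    frac-* k i = *≡* (cong (λ d → (+ k ℤ.* i) ℤ.* (+ suc d)) (sym (+-identityʳ e)))

  i-1<i : ∀ i → i ℤ.- + 1 ℤ.< i
  i-1<i i = subst (i ℤ.- + 1 ℤ.<_) (ℤ.+-identityʳ i) (ℤ.+-monoʳ-< i ℤ.-<+)

  ^-≤-cancel : ∀ {x y} → 2 ^ x ≤ 2 ^ y → x ≤ y
  ^-≤-cancel {x} {y} 2^x≤2^y = ≮⇒≥ λ y<x → <⇒≱ (^-monoʳ-< 2 (s≤s z<s) y<x) 2^x≤2^y

  -- Rounding a / c down to an integer leaves the integer part of its logarithm unchanged.
  floor-log : ∀ a c .{{_ : NonZero c}} → c ≤ a → ∃[ s ] (2 ^ s * c ≤ a × a < 2 ^ suc s * c)
  floor-log a c c≤a = ⌊log₂ a / c ⌋ ,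
    ≤-trans (*-monoˡ-≤ c (2^log≤n (a / c) {{>-nonZero (m≥n⇒m/n>0 c≤a)}})) (m/n*n≤m a c) ,
    <-≤-trans (m<[1+m/K]*K a c) (*-monoˡ-≤ c (subst (_≤ 2 ^ suc ⌊log₂ a / c ⌋) (+-comm 1 (a / c)) (n<2^[1+log] (a / c))))

  -- The cut is open and equality may hold in the hypothesis, so one unit of the numerator is given
  -- up; for s = 0 this leads to the negative clause of the logarithm.
  below-log : ∀ {a c s} e .{{_ : NonZero c}} → 2 ^ s * c ^ suc e ≤ a ^ suc e →
              log₂[ a / c ] (mkℚᵘ (+ s ℤ.- + 1) e)
  below-log {a} {c} {zero} e ≤a = begin-strict
    c ^ suc e               ≡⟨ *-identityˡ (c ^ suc e) ⟨
    1 * c ^ suc e           <⟨ *-monoˡ-< (c ^ suc e) {{m^n≢0 c (suc e)}} {1} {2} (s≤s z<s) ⟩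
    2 * c ^ suc e           ≤⟨ *-monoʳ-≤ 2 (subst (_≤ a ^ suc e) (*-identityˡ _) ≤a) ⟩
    2 * a ^ suc e           ∎
    where open ≤-Reasoning
  below-log {a} {c} {suc s} e ≤a =
    <-≤-trans (*-monoˡ-< (c ^ suc e) {{m^n≢0 c (suc e)}} (^-monoʳ-< 2 (s≤s z<s) (n<1+n s))) ≤a

  -- The numerator k s - (k + 1) loses k because s - 1 is multiplied by k, and 1 more because the
  -- product is an open cut again. The first component keeps the matching upper estimate of the
  -- logarithm.
  below-·log : ∀ k {n} e → k ≤ n →
    ∃[ s ] ((n ^ suc e) ^ k ≤ (2 ^ suc s * k ^ suc e) ^ k ×
            (k ·ᴿ log₂[ n / k ]) (mkℚᵘ (+ (k * s) ℤ.- + suc k) e))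
  below-·log zero      e _   = 0 , ≤-refl , *<* ℤ.-<+
  below-·log k@(suc _) {n} e k≤n with floor-log (n ^ suc e) (k ^ suc e) {{m^n≢0 k (suc e)}} (^-monoˡ-≤ (suc e) k≤n)
  ... | s , lo , hi = s , ^-monoˡ-≤ k (<⇒≤ hi) , mkℚᵘ (+ s ℤ.- + 1) e , below-log {s = s} e lo ,
    ℚ.<-respʳ-≃ (ℚ.≃-sym (frac-* e k (+ s ℤ.- + 1))) (frac-< e
      (subst (+ (k * s) ℤ.- + suc k ℤ.<_) expand
        (ℤ.+-monoʳ-< (+ (k * s)) (ℤ.neg-mono-< (ℤ.+<+ (n<1+n k))))))
    where
    distrib : ∀ k s → k ℤ.* s ℤ.- k ≡ k ℤ.* (s ℤ.- + 1)
    distrib = ℤ.solve-∀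
    expand : + (k * s) ℤ.- + k ≡ + k ℤ.* (+ s ℤ.- + 1)
    expand = trans (cong (ℤ._- + k) (ℤ.pos-* k s)) (distrib (+ k) (+ s))

  -- Since 0 ^ 0 = 1, the cancellation below also covers empty and full sets.
  n^n≢0 : ∀ n → NonZero (n ^ n)
  n^n≢0 zero    = _
  n^n≢0 (suc n) = m^n≢0 (suc n) (suc n)

  ^-distrib-* : ∀ a b k → (a * b) ^ k ≡ a ^ k * b ^ k
  ^-distrib-* a b zero    = refl
  ^-distrib-* a b (suc k) = trans (cong (a * b *_) (^-distrib-* a b k)) ([m*n]*[o*p]≡[m*o]*[n*p] a b (a ^ k) (b ^ k))

  ^-swap₂ : ∀ x m n → (x ^ m) ^ n ≡ (x ^ n) ^ m
  ^-swap₂ x m n = trans (^-*-assoc x m n) (trans (cong (x ^_) (*-comm m n)) (sym (^-*-assoc x n m)))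

  module _ (A m q : ℕ) where

    private
      n = m + q

    -- Split n ^ (d n) into its m-part and q-part and bound each by its logarithm estimate. Both
    -- sides then contain the d-th power of m ^ m * q ^ q; cancelling it leaves powers of 2.
    exponent-≤ : ∀ d {s₁ s₂} → 2 ^ A * (m ^ m * q ^ q) ≤ n ^ n →
      (n ^ d) ^ m ≤ (2 ^ suc s₁ * m ^ d) ^ m → (n ^ d) ^ q ≤ (2 ^ suc s₂ * q ^ d) ^ q →
      A * d ≤ m * suc s₁ + q * suc s₂
    exponent-≤ d {s₁} {s₂} packed lo₁ lo₂ = ^-≤-cancel (*-cancelʳ-≤ _ _ (W ^ d) {{W^d≢0}} (begin
      2 ^ (A * d) * W ^ d                 ≡⟨ cong (_* W ^ d) (^-*-assoc 2 A d) ⟨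
      (2 ^ A) ^ d * W ^ d                 ≡⟨ ^-distrib-* (2 ^ A) W d ⟨
      (2 ^ A * W) ^ d                     ≤⟨ ^-monoˡ-≤ d packed ⟩
      (n ^ n) ^ d                         ≡⟨ ^-swap₂ n n d ⟩
      (n ^ d) ^ n                         ≡⟨ ^-distribˡ-+-* (n ^ d) m q ⟩
      (n ^ d) ^ m * (n ^ d) ^ q           ≤⟨ *-mono-≤ lo₁ lo₂ ⟩
      (2 ^ suc s₁ * m ^ d) ^ m * (2 ^ suc s₂ * q ^ d) ^ q
        ≡⟨ cong₂ _*_ (pull s₁ m) (pull s₂ q) ⟩
      (2 ^ (m * suc s₁) * (m ^ m) ^ d) * (2 ^ (q * suc s₂) * (q ^ q) ^ d)
        ≡⟨ [m*n]*[o*p]≡[m*o]*[n*p] (2 ^ (m * suc s₁)) _ _ _ ⟩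
      (2 ^ (m * suc s₁) * 2 ^ (q * suc s₂)) * ((m ^ m) ^ d * (q ^ q) ^ d)
        ≡⟨ cong₂ _*_ (^-distribˡ-+-* 2 (m * suc s₁) _) (^-distrib-* (m ^ m) (q ^ q) d) ⟨
      2 ^ (m * suc s₁ + q * suc s₂) * W ^ d ∎))
      where
      open ≤-Reasoning
      W = m ^ m * q ^ q
      W^d≢0 : NonZero (W ^ d)
      W^d≢0 = m^n≢0 W d {{m*n≢0 (m ^ m) (q ^ q) {{n^n≢0 m}} {{n^n≢0 q}}}}
      pull : ∀ s k → (2 ^ suc s * k ^ d) ^ k ≡ 2 ^ (k * suc s) * (k ^ k) ^ d
      pull s k = trans (^-distrib-* (2 ^ suc s) (k ^ d) k)
        (cong₂ _*_ (trans (^-*-assoc 2 (suc s) k) (cong (2 ^_) (*-comm (suc s) k))) (^-swap₂ k d k))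

    -- With denominator d = 2 n + 4 all the roundings together cost at most 1.
    entropy-≥ : ∀ r → 2 ^ A * (m ^ m * q ^ q) ≤ n ^ n →
      fromℕᴿ (A + r) ≤ᴿ (m ·ᴿ log₂[ n / m ] +ᴿ q ·ᴿ log₂[ n / q ]) +ᴿ fromℕᴿ (r + 1)
    entropy-≥ r packed t t<A+r
      with below-·log m {n} (3 + 2 * n) (m≤m+n m q) | below-·log q {n} (3 + 2 * n) (m≤n+m q m)
    ... | s₁ , lo₁ , in₁ | s₂ , lo₂ , in₂ =
      mkℚᵘ z e , mkℚᵘ z′ e ,
      (mkℚᵘ a₁ e , mkℚᵘ a₂ e , in₁ , in₂ ,
        ℚ.<-respʳ-≃ (ℚ.≃-sym (frac-+ e a₁ a₂)) (frac-< e (i-1<i (a₁ ℤ.+ a₂)))) ,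
      ℚ.<-respʳ-≃ (ℚ.≃-sym (frac-ℕ e (r + 1))) (frac-< e (i-1<i _)) ,
      ℚ.<-respʳ-≃ (ℚ.≃-sym (frac-+ e z z′)) (ℚ.<-≤-trans (ℚ.<-respʳ-≃ (frac-ℕ e (A + r)) t<A+r) (frac-≤ e A+r≤))
      where
      -- In units of 1 / d: `exponent-≤` rounds up by n in total, `a₁` and `a₂` round down by n + 2,
      -- and the two open sums take 1 each. That makes 2 n + 4 = d.
      e = 3 + 2 * n
      a₁ = + (m * s₁) ℤ.- + suc m
      a₂ = + (q * s₂) ℤ.- + suc q
      z  = (a₁ ℤ.+ a₂) ℤ.- + 1
      z′ = + (r + 1) ℤ.* + suc e ℤ.- + 1
      ring : ∀ m q s₁ s₂ r →
        (m ℤ.* (+ 1 ℤ.+ s₁) ℤ.+ q ℤ.* (+ 1 ℤ.+ s₂)) ℤ.+ r ℤ.* (+ 4 ℤ.+ + 2 ℤ.* (m ℤ.+ q)) ≡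
        (((m ℤ.* s₁ ℤ.- (+ 1 ℤ.+ m)) ℤ.+ (q ℤ.* s₂ ℤ.- (+ 1 ℤ.+ q))) ℤ.- + 1) ℤ.+
          ((r ℤ.+ + 1) ℤ.* (+ 4 ℤ.+ + 2 ℤ.* (m ℤ.+ q)) ℤ.- + 1)
      ring = ℤ.solve-∀
      d≡ : + suc e ≡ + 4 ℤ.+ + 2 ℤ.* (+ m ℤ.+ + q)
      d≡ = trans (ℤ.pos-+ 4 (2 * n)) (cong (λ x → + 4 ℤ.+ x) (trans (ℤ.pos-* 2 n) (cong (λ x → + 2 ℤ.* x) (ℤ.pos-+ m q))))
      lhs≡ : + ((m * suc s₁ + q * suc s₂) + r * suc e) ≡
        (+ m ℤ.* (+ 1 ℤ.+ + s₁) ℤ.+ + q ℤ.* (+ 1 ℤ.+ + s₂)) ℤ.+ + r ℤ.* (+ 4 ℤ.+ + 2 ℤ.* (+ m ℤ.+ + q))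
      lhs≡ = trans (ℤ.pos-+ (m * suc s₁ + q * suc s₂) (r * suc e)) (cong₂ ℤ._+_
        (trans (ℤ.pos-+ (m * suc s₁) (q * suc s₂)) (cong₂ ℤ._+_ (ℤ.pos-* m (suc s₁)) (ℤ.pos-* q (suc s₂))))
        (trans (ℤ.pos-* r (suc e)) (cong (λ x → + r ℤ.* x) d≡)))
      rhs≡ : z ℤ.+ z′ ≡ (((+ m ℤ.* + s₁ ℤ.- (+ 1 ℤ.+ + m)) ℤ.+ (+ q ℤ.* + s₂ ℤ.- (+ 1 ℤ.+ + q))) ℤ.- + 1) ℤ.+
          ((+ r ℤ.+ + 1) ℤ.* (+ 4 ℤ.+ + 2 ℤ.* (+ m ℤ.+ + q)) ℤ.- + 1)
      rhs≡ = cong₂ ℤ._+_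
        (cong₂ (λ x y → ((x ℤ.- + suc m) ℤ.+ (y ℤ.- + suc q)) ℤ.- + 1) (ℤ.pos-* m s₁) (ℤ.pos-* q s₂))
        (cong₂ (λ x y → x ℤ.* y ℤ.- + 1) (ℤ.pos-+ r 1) d≡)
      A+r≤ : + (A + r) ℤ.* + suc e ℤ.≤ z ℤ.+ z′
      A+r≤ = subst₂ ℤ._≤_
        (trans (cong +_ (sym (*-distribʳ-+ (suc e) A r))) (ℤ.pos-* (A + r) (suc e)))
        (trans lhs≡ (trans (ring (+ m) (+ q) (+ s₁) (+ s₂) (+ r)) (sym rhs≡)))
        (ℤ.+≤+ (+-monoˡ-≤ (r * suc e) (exponent-≤ (suc e) packed lo₁ lo₂)))

open EntropyBound using (entropy-≥)

-- The total length of the codes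

module _ (b : ℕ) (σ : ℕ → Bool) where

  open Blocks b σ

  -- The part of a code length that is charged to the entropy; the one bit left over in each block
  -- is redundancy.
  exponent : ℕ → ℕ
  exponent k = ⌊log₂ length (class b (size (block k))) ⌋

  module _ (p q : ℕ) where
    open Weights p q

    weight-block : ∀ k → weight (λ j → σ (k * b + j)) b ≡ weight (bit (block k)) b
    weight-block k = weight-cong-ones _ _ b (sum<-cong b λ j j<b → cong [_]₁ (sym (bit-block k j j<b)))

    packed-blocks : ∀ K → 2 ^ sum< exponent K * weight σ (K * b) ≤ (p + q) ^ (K * b)
    packed-blocks zero    = ≤-refl
    packed-blocks (suc K) = begin
      2 ^ sum< exponent (suc K) * weight σ (b + K * b)
        ≡⟨ cong₂ _*_ (trans (cong (2 ^_) (sum<-suc exponent K)) (^-distribˡ-+-* 2 A (exponent K)))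
                     (trans (cong (weight σ) (+-comm b (K * b)))
                       (trans (weight-+ σ (K * b) b) (cong (weight σ (K * b) *_) (weight-block K)))) ⟩
      (2 ^ A * 2 ^ exponent K) * (weight σ (K * b) * weight (bit (block K)) b)
        ≡⟨ [m*n]*[o*p]≡[m*o]*[n*p] (2 ^ A) _ _ _ ⟩
      (2 ^ A * weight σ (K * b)) * (2 ^ exponent K * weight (bit (block K)) b)
        ≤⟨ *-mono-≤ (packed-blocks K) (≤-trans (*-monoˡ-≤ _ 2^exponent≤) (class-weight-≤ p q (block K))) ⟩
      (p + q) ^ (K * b) * (p + q) ^ b
        ≡⟨ ^-distribˡ-+-* (p + q) (K * b) b ⟨
      (p + q) ^ (K * b + b)
        ≡⟨ cong ((p + q) ^_) (+-comm (K * b) b) ⟩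
      (p + q) ^ (suc K * b) ∎
      where
      open ≤-Reasoning
      A = sum< exponent K
      2^exponent≤ : 2 ^ exponent K ≤ length (class b (size (block K)))
      2^exponent≤ = 2^log≤n _ {{>-nonZero (≤-<-trans z≤n (code<∣class∣ (block K)))}}

    -- Past the K complete blocks the crude bound `weight-≤` is enough, because the code of the
    -- incomplete block, at most b + 1 bits, counts as redundancy.
    packed-prefix : ∀ K {n} → K * b ≤ n → 2 ^ sum< exponent K * weight σ n ≤ (p + q) ^ n
    packed-prefix K {n} Kb≤n = begin
      2 ^ A * weight σ n                                        ≡⟨ cong (λ j → 2 ^ A * weight σ j) split ⟨
      2 ^ A * weight σ (K * b + rest)                           ≡⟨ cong (2 ^ A *_) (weight-+ σ (K * b) rest) ⟩
      2 ^ A * (weight σ (K * b) * weight tail rest)             ≡⟨ *-assoc (2 ^ A) _ _ ⟨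
      2 ^ A * weight σ (K * b) * weight tail rest               ≤⟨ *-mono-≤ (packed-blocks K) (weight-≤ tail rest) ⟩
      (p + q) ^ (K * b) * (p + q) ^ rest                        ≡⟨ ^-distribˡ-+-* (p + q) (K * b) rest ⟨
      (p + q) ^ (K * b + rest)                                  ≡⟨ cong ((p + q) ^_) split ⟩
      (p + q) ^ n                                               ∎
      where
      open ≤-Reasoning
      A = sum< exponent K
      rest = n ∸ K * b
      tail = λ j → σ (K * b + j)
      split : K * b + rest ≡ n
      split = m+[n∸m]≡n Kb≤n

  sum<-suc∘ : ∀ g i → sum< (suc ∘ g) i ≡ sum< g i + i
  sum<-suc∘ g zero    = refl
  sum<-suc∘ g (suc i) = trans (cong (λ x → suc (g 0 + x)) (sum<-suc∘ (g ∘ suc) i))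
    (trans (cong suc (sym (+-assoc (g 0) _ i))) (sym (+-suc _ i)))

  pointer-≤ : ∀ K → pointer (suc K) ≤ sum< exponent K + (K + suc b)
  pointer-≤ K = begin
    pointer (suc K)                     ≡⟨ sum<-suc blockLength K ⟩
    pointer K + blockLength K           ≤⟨ +-mono-≤ (≤-reflexive (sum<-suc∘ exponent K)) (codeLength-≤ b (size (block K))) ⟩
    sum< exponent K + K + suc b         ≡⟨ +-assoc (sum< exponent K) K (suc b) ⟩
    sum< exponent K + (K + suc b)       ∎
    where open ≤-Reasoning

-- Space

-- The first eleven sections have the same size for every σ, so a constant sequence stands in for S.
-- The rest is one bit per complete block and the code of the last block.
redundancy₀ : ℕ → ℕ
redundancy₀ n = sum< (Rep.sectionSize (λ _ → false)) 11 + (n / b + suc b)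
  where open Parameters n

redundancy : ℕ → ℕ
redundancy n = redundancy₀ n + 1

fromℕ-mono : ∀ {x y} → x ≤ y → fromℕᴿ x ≤ᴿ fromℕᴿ y
fromℕ-mono x≤y q q<x = ℚ.<-≤-trans q<x (*≤* (ℤ.*-monoʳ-≤-nonNeg (ℤ.+ 1) (ℤ.+≤+ x≤y)))

space : ∀ n (S : Subset n) →
  fromℕᴿ (length (Parameters.Rep.representation n (bit S))) ≤ᴿ nH₀ S +ᴿ fromℕᴿ (redundancy n)
space n S q q<length = subst₂ (λ a c → ((a ·ᴿ log₂[ n / a ] +ᴿ c ·ᴿ log₂[ n / c ]) +ᴿ fromℕᴿ (redundancy n)) q)
  (sym (size≡ones S)) (sym n∸m≡z)
  (subst (λ n′ → ((m ·ᴿ log₂[ n′ / m ] +ᴿ z ·ᴿ log₂[ n′ / z ]) +ᴿ fromℕᴿ (redundancy n)) q) m+z≡n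
    (entropy-≥ A m z (redundancy₀ n) packed q (fromℕ-mono length≤ q q<length)))
  where
  open Parameters n
  σ = bit S
  open Rep σ
  m = ones σ n
  z = ones (not ∘ σ) n
  A = sum< (exponent b σ) (n / b)
  m+z≡n : m + z ≡ n
  m+z≡n = ones+zeros σ n
  n∸m≡z : n ∸ ∣ S ∣ ≡ z
  n∸m≡z = trans (cong₂ _∸_ (sym m+z≡n) (size≡ones S)) (m+n∸m≡n m z)
  packed : 2 ^ A * (m ^ m * z ^ z) ≤ (m + z) ^ (m + z)
  packed = subst (λ i → 2 ^ A * (m ^ m * z ^ z) ≤ (m + z) ^ i) (sym m+z≡n)
    (packed-prefix b σ m z (n / b) (m/n*n≤m n b))
  length≤ : length representation ≤ A + redundancy₀ n
  length≤ = begin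
    length representation                             ≡⟨ length-representation ⟩
    sum< sectionSize 12                               ≡⟨ sum<-suc sectionSize 11 ⟩
    sum< sectionSize 11 + pointer N                   ≤⟨ +-monoʳ-≤ (sum< sectionSize 11) (pointer-≤ b σ (n / b)) ⟩
    sum< sectionSize 11 + (A + (n / b + suc b))       ≡⟨ swap (sum< sectionSize 11) A _ ⟩
    A + (sum< sectionSize 11 + (n / b + suc b))       ∎
    where
    open ≤-Reasoning
    swap : ∀ x y z → x + (y + z) ≡ y + (x + z)
    swap = solve-∀

sum<-≤-scaled : ∀ {g c} u i → (∀ j → j < i → g j * u ≤ c) → sum< g i * u ≤ i * c
sum<-≤-scaled         u zero    g≤c = z≤n
sum<-≤-scaled {g} {c} u (suc i) g≤c = ≤-trans (≤-reflexive (*-distribʳ-+ u (g 0) _))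
  (+-mono-≤ (g≤c 0 z<s) (sum<-≤-scaled u i λ j j<i → g≤c (suc j) (s<s j<i)))

redundancy-sum : ∀ x y z {n G} u i c → x * u ≤ i * (c * G) → y * u ≤ n → z * u ≤ n → u ≤ n → n ≤ G →
             (x + (y + z) + 1) * u ≤ (i * c + 3) * G
redundancy-sum x y z {n} {G} u i c x≤ y≤ z≤ u≤ n≤G = begin
  (x + (y + z) + 1) * u               ≡⟨ expand x y z u ⟩
  x * u + (y * u + (z * u + u))       ≤⟨ +-mono-≤ x≤ (+-mono-≤ (≤-trans y≤ n≤G)
                                           (+-mono-≤ (≤-trans z≤ n≤G) (≤-trans u≤ n≤G))) ⟩
  i * (c * G) + (G + (G + G))         ≡⟨ collect i c G ⟩
  (i * c + 3) * G                     ∎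
  where
  open ≤-Reasoning
  expand : ∀ x y z u → (x + (y + z) + 1) * u ≡ x * u + (y * u + (z * u + u))
  expand = solve-∀
  collect : ∀ i c G → i * (c * G) + (G + (G + G)) ≡ (i * c + 3) * G
  collect = solve-∀

-- Each section is O(n ℓ / u)

module Redundancy (n : ℕ) where

  open Parameters n
  open Rep (λ _ → false)

  module _ (12ℓ≤u : 12 * ℓ ≤ u) where

    open Powers (2 ^ ℓ) (^-monoʳ-≤ 2 (s≤s {n = ⌊log₂ L ⌋} z≤n))

    M : ℕ
    M = 2 ^ b

    12≤b : 12 ≤ b
    12≤b = ≤-trans (m≤m*n 12 ℓ) (≤-trans 12ℓ≤u u≤b)

    -- The assumption 12 ℓ ≤ u ≤ b puts polynomials in L of degree at most 12 below 2 ^ b.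
    small : ∀ {x} i → i ≤ 12 → x ≲ i → x ≤ M
    small {x} i i≤12 x≲i = begin
      x              ≤⟨ ≲-mono i≤12 x≲i ⟩
      (2 ^ ℓ) ^ 12   ≡⟨ ^-swap 2 ℓ 12 ⟩
      2 ^ (12 * ℓ)   ≤⟨ ^-monoʳ-≤ 2 (≤-trans 12ℓ≤u u≤b) ⟩
      M              ∎
      where open ≤-Reasoning

    log-n≢0 : ⌊log₂ n ⌋ ≢ 0
    log-n≢0 log≡0 = <⇒≱ (s≤s z<s) (≤-trans (≤-trans (≤-trans (m≤m+n 2 10) 12≤b) b≤L) (≤-reflexive (cong suc log≡0)))

    -- Here b² ≤ L matters: for b ≥ 3 it gives 2 b < L, that is, 2 b ≤ `⌊log₂ n ⌋`.
    M*M≤n : M * M ≤ n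
    M*M≤n = begin
      2 ^ b * 2 ^ b   ≡⟨ ^-distribˡ-+-* 2 b b ⟨
      2 ^ (b + b)     ≤⟨ ^-monoʳ-≤ 2 (s≤s⁻¹ b+b<L) ⟩
      2 ^ ⌊log₂ n ⌋   ≤⟨ 2^log≤n n {{≢-nonZero λ n≡0 → log-n≢0 (cong ⌊log₂_⌋ n≡0)}} ⟩
      n               ∎
      where
      open ≤-Reasoning
      b+b<L : b + b < L
      b+b<L = begin-strict
        b + b         <⟨ m<n+m (b + b) (>-nonZero⁻¹ b) ⟩
        b + (b + b)   ≡⟨ cong (λ x → b + (b + x)) (+-identityʳ b) ⟨
        3 * b         ≤⟨ *-monoˡ-≤ b (≤-trans (m≤m+n 3 9) 12≤b) ⟩
        b * b         ≤⟨ b*b≤L ⟩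
        L             ∎

    M≤n : M ≤ n
    M≤n = ≤-trans (m≤m*n M M {{m^n≢0 2 b}}) M*M≤n

    L≲1 : L ≲ 1
    L≲1 = ≲1 (<⇒≤ L<2^ℓ)

    u≲1 : u ≲ 1
    u≲1 = ≤-trans u≤L L≲1

    b≲1 : b ≲ 1
    b≲1 = ≤-trans b≤L L≲1

    Q≲2 : Q ≲ 2
    Q≲2 = ≲-* {i = 1} {1} L≲1 L≲1

    small-n : ∀ {x} i {i≤12 : T (i ≤ᵇ 12)} → x ≲ i → x ≤ n
    small-n i {i≤12} x≲i = ≤-trans (small i (≤ᵇ⇒≤ i 12 i≤12) x≲i) M≤n

    N*b≤2n : N * b ≤ 2 * n
    N*b≤2n = ≤-trans (+-mono-≤ (small-n 1 b≲1) (m/n*n≤m n b)) (≤-reflexive (cong (n +_) (sym (+-identityʳ n))))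

    N≤2n : N ≤ 2 * n
    N≤2n = ≤-trans (m≤m*n N b) N*b≤2n

    4n : ∀ {x y} → x ≤ 2 * n → y ≤ 2 * n → x + y ≤ 4 * n
    4n x≤ y≤ = ≤-trans (+-mono-≤ x≤ y≤) (≤-reflexive (sym (*-distribʳ-+ n 2 2)))

    2n : ∀ {x} → x ≤ n → x ≤ 2 * n
    2n x≤n = ≤-trans x≤n (m≤m+n n (n + 0))

    -- A wide entry has 32 L bits, so O(n / (L u)) of them are affordable; narrow entries of 4 ℓ
    -- bits may number O(n / u). The common constant is 32 * 4.
    wide-≤ : ∀ c → c * (L * u) ≤ 4 * n → sum< (λ _ → w) c * u ≤ 128 * (ℓ * n)
    wide-≤ c c≤ = begin
      sum< (λ _ → w) c * u     ≡⟨ cong (_* u) (sum<-const w c) ⟩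
      c * (32 * L) * u         ≡⟨ pull c 32 L u ⟩
      32 * (c * (L * u))       ≤⟨ *-monoʳ-≤ 32 c≤ ⟩
      32 * (4 * n)             ≡⟨ *-assoc 32 4 n ⟨
      128 * n                  ≤⟨ *-monoʳ-≤ 128 (m≤n*m n ℓ) ⟩
      128 * (ℓ * n)            ∎
      where
      open ≤-Reasoning
      pull : ∀ c k L u → c * (k * L) * u ≡ k * (c * (L * u))
      pull = solve-∀

    narrow-≤ : ∀ c → c * u ≤ 4 * n → sum< (λ _ → ρ) c * u ≤ 128 * (ℓ * n)
    narrow-≤ c c≤ = begin
      sum< (λ _ → ρ) c * u     ≡⟨ cong (_* u) (sum<-const ρ c) ⟩
      c * (4 * ℓ) * u          ≡⟨ pull c 4 ℓ u ⟩
      4 * ℓ * (c * u)          ≤⟨ *-monoʳ-≤ (4 * ℓ) c≤ ⟩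
      4 * ℓ * (4 * n)          ≡⟨ pull′ 4 ℓ 4 n ⟩
      16 * (ℓ * n)             ≤⟨ *-monoˡ-≤ (ℓ * n) (m≤m+n 16 112) ⟩
      128 * (ℓ * n)            ∎
      where
      open ≤-Reasoning
      pull : ∀ c k ℓ u → c * (k * ℓ) * u ≡ k * ℓ * (c * u)
      pull = solve-∀
      pull′ : ∀ k ℓ j n → k * ℓ * (j * n) ≡ k * j * (ℓ * n)
      pull′ = solve-∀

    superblocks-≤ : (2 + N / Q) * (L * u) ≤ 4 * n
    superblocks-≤ = begin
      (2 + N / Q) * (L * u)     ≤⟨ *-monoʳ-≤ (2 + N / Q) (*-monoʳ-≤ L u≤L) ⟩
      (2 + N / Q) * Q           ≡⟨ *-distribʳ-+ Q 2 (N / Q) ⟩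
      2 * Q + N / Q * Q         ≤⟨ 4n (*-monoʳ-≤ 2 (small-n 2 Q≲2)) (≤-trans (m/n*n≤m N Q) N≤2n) ⟩
      4 * n                     ∎
      where open ≤-Reasoning

    blocks-≤ : (1 + N) * u ≤ 4 * n
    blocks-≤ = 4n (2n (small-n 1 u≲1)) (≤-trans (*-monoʳ-≤ N u≤b) N*b≤2n)

    coarse-≤ : (1 + n / K₁) * K₁ ≤ 4 * n
    coarse-≤ = 4n (2n (small-n 2 (≲-* {i = 1} {1} L≲1 u≲1))) (2n (m/n*n≤m n K₁))

    -- The step K₁ = L u squares to Q b, so the product is about N b, which is at most 2 n.
    coarseSpan-≤ : (1 + N / Q) * K₁ * (L * u) ≤ 4 * n
    coarseSpan-≤ = begin
      (1 + N / Q) * (L * u) * (L * u)      ≡⟨ regroup (1 + N / Q) L u ⟩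
      (1 + N / Q) * Q * b                  ≤⟨ *-monoˡ-≤ b (+-monoʳ-≤ Q (m/n*n≤m N Q)) ⟩
      (Q + N) * b                          ≡⟨ *-distribʳ-+ b Q N ⟩
      Q * b + N * b                        ≤⟨ 4n (2n (small-n 3 (≲-* {i = 2} {1} Q≲2 b≲1))) N*b≤2n ⟩
      4 * n                                ∎
      where
      open ≤-Reasoning
      regroup : ∀ c L u → c * (L * u) * (L * u) ≡ c * (L * L) * (u * u)
      regroup = solve-∀

    fine-≤ : (1 + n / u) * u ≤ 4 * n
    fine-≤ = 4n (2n (small-n 1 u≲1)) (2n (m/n*n≤m n u))

    fineSpan-≤ : N * u * u ≤ 4 * n
    fineSpan-≤ = ≤-trans (≤-reflexive (*-assoc N u u)) (≤-trans N*b≤2n (*-monoˡ-≤ n (m≤m+n 2 2)))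

    table-≤ : suc b * 2 ^ b * b * u ≤ 4 * n
    table-≤ = begin
      suc b * M * b * u      ≡⟨ regroup (suc b) M b u ⟩
      suc b * b * u * M      ≤⟨ *-monoˡ-≤ M (small 3 (m≤m+n 3 9) (≲-* {i = 2} {1} (≲-* {i = 1} {1} 1+b≲1 b≲1) u≲1)) ⟩
      M * M                  ≤⟨ M*M≤n ⟩
      n                      ≤⟨ m≤n*m n 4 ⟩
      4 * n                  ∎
      where
      open ≤-Reasoning
      1+b≲1 : suc b ≲ 1
      1+b≲1 = ≲1 (≤-trans (s≤s b≤L) L<2^ℓ)
      regroup : ∀ x M b u → x * M * b * u ≡ x * b * u * M
      regroup = solve-∀

    sectionSize-≤ : ∀ a → a < 11 → sectionSize a * u ≤ 128 * (ℓ * n)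
    sectionSize-≤ header      _ = wide-≤ 18 (≤-trans
      (small-n 7 (≲-* {i = 5} {2} (≤-trans (m≤m+n 18 14) (2^≲ 5)) (≲-* {i = 1} {1} L≲1 u≲1))) (m≤n*m n 4))
    sectionSize-≤ rankAbs     _ = wide-≤ (2 + N / Q) superblocks-≤
    sectionSize-≤ rankRel     _ = narrow-≤ (1 + N) blocks-≤
    sectionSize-≤ pointerAbs  _ = wide-≤ (2 + N / Q) superblocks-≤
    sectionSize-≤ pointerRel  _ = narrow-≤ (1 + N) blocks-≤
    sectionSize-≤ coarse      _ = wide-≤ (1 + n / K₁) coarse-≤
    sectionSize-≤ coarseSpan  _ = wide-≤ ((1 + N / Q) * K₁) coarseSpan-≤
    sectionSize-≤ fine        _ = narrow-≤ (1 + n / u) fine-≤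
    sectionSize-≤ fineSpan    _ = narrow-≤ (N * u) fineSpan-≤
    sectionSize-≤ rankTable   _ = narrow-≤ (suc b * 2 ^ b * b) table-≤
    sectionSize-≤ selectTable _ = narrow-≤ (suc b * 2 ^ b * b) table-≤
    sectionSize-≤ (suc (suc (suc (suc (suc (suc (suc (suc (suc (suc (suc _)))))))))))
      (s≤s (s≤s (s≤s (s≤s (s≤s (s≤s (s≤s (s≤s (s≤s (s≤s (s≤s ())))))))))))

    redundancy-≤ : redundancy n * u ≤ (11 * 128 + 3) * (ℓ * n)
    redundancy-≤ = redundancy-sum (sum< sectionSize 11) (n / b) (suc b) u 11 128 (sum<-≤-scaled {sectionSize} u 11 sectionSize-≤)
      (≤-trans (*-monoʳ-≤ (n / b) u≤b) (m/n*n≤m n b))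
      (small-n 2 (≲-* {i = 1} {1} (≲1 (≤-trans (s≤s b≤L) L<2^ℓ)) u≲1))
      (small-n 1 u≲1) (m≤n*m n ℓ)

-- Growth of the parameters

-- At s = 2 c + 1 the left side is 2 c (c + 1), where c and c + 1 are at most 2 ^ c. Each further
-- step doubles the right side and at most doubles the left.
linear≤2^ : ∀ c s → 2 * c + 1 ≤ s → c * suc s ≤ 2 ^ s
linear≤2^ c s big = subst (λ s → c * suc s ≤ 2 ^ s) (m+[n∸m]≡n big) (go (s ∸ (2 * c + 1)))
  where
  open ≤-Reasoning
  go : ∀ t → c * suc (2 * c + 1 + t) ≤ 2 ^ (2 * c + 1 + t)
  go zero = begin
    c * suc (2 * c + 1 + 0)   ≡⟨ regroup c ⟩
    2 * (c * (1 + c))         ≤⟨ *-monoʳ-≤ 2 (*-mono-≤ (<⇒≤ (n<2^n c)) (n<2^n c)) ⟩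
    2 * (2 ^ c * 2 ^ c)       ≡⟨ cong (2 *_) (^-distribˡ-+-* 2 c c) ⟨
    2 ^ suc (c + c)           ≡⟨ cong (2 ^_) (regroup′ c) ⟩
    2 ^ (2 * c + 1 + 0)       ∎
    where
    regroup : ∀ c → c * suc (2 * c + 1 + 0) ≡ 2 * (c * (1 + c))
    regroup = solve-∀
    regroup′ : ∀ c → suc (c + c) ≡ 2 * c + 1 + 0
    regroup′ = solve-∀
  go (suc t) = begin
    c * suc (2 * c + 1 + suc t)     ≡⟨ cong (λ x → c * suc x) (+-suc (2 * c + 1) t) ⟩
    c * suc (suc r)                 ≤⟨ *-monoʳ-≤ c (+-mono-≤ (s≤s {n = r} z≤n) (m≤m+n (suc r) 0)) ⟩
    c * (2 * suc r)                 ≡⟨ swap c 2 (suc r) ⟩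
    2 * (c * suc r)                 ≤⟨ *-monoʳ-≤ 2 (go t) ⟩
    2 ^ suc r                       ≡⟨ cong (2 ^_) (+-suc (2 * c + 1) t) ⟨
    2 ^ (2 * c + 1 + suc t)         ∎
    where
    r = 2 * c + 1 + t
    swap : ∀ x y z → x * (y * z) ≡ y * (x * z)
    swap = solve-∀

log-≥ : ∀ {k n} → 2 ^ k ≤ n → k ≤ ⌊log₂ n ⌋
log-≥ {k} 2^k≤n = subst (_≤ _) (⌊log₂[2^n]⌋≡n k) (⌊log₂⌋-mono-≤ 2^k≤n)

-- As ℓ ≤ 4 (s + 1) and u = 2 ^ s, a large s is enough; s is a quarter of an iterated logarithm,
-- hence the double exponential in the threshold.
ℓ-u-growth : ∀ c → ∃[ n₀ ] (∀ n → n ≥ n₀ → c * Parameters.ℓ n ≤ Parameters.u n)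
ℓ-u-growth c = 2 ^ (2 ^ (s₀ * 4)) , bound
  where
  s₀ = 2 * (c * 4) + 1
  bound : ∀ n → n ≥ 2 ^ (2 ^ (s₀ * 4)) → c * Parameters.ℓ n ≤ Parameters.u n
  bound n n≥ = begin
    c * ℓ               ≤⟨ *-monoʳ-≤ c ℓ≤ ⟩
    c * (4 * suc s)     ≡⟨ *-assoc c 4 (suc s) ⟨
    c * 4 * suc s       ≤⟨ linear≤2^ (c * 4) s s₀≤s ⟩
    u                   ∎
    where
    open Parameters n
    open ≤-Reasoning
    ℓ≤ : ℓ ≤ 4 * suc s
    ℓ≤ = subst (ℓ ≤_) (trans (cong (_* 4) (+-comm s 1)) (*-comm (suc s) 4)) (m<[1+m/K]*K ⌊log₂ L ⌋ 4)
    s₀≤s : s₀ ≤ s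
    s₀≤s = subst (_≤ s) (m*n/n≡m s₀ 4) (/-monoˡ-≤ 4 (log-≥ {s₀ * 4} (≤-trans (log-≥ {2 ^ (s₀ * 4)} n≥) (n≤1+n ⌊log₂ n ⌋))))

cancel-scale : ∀ {k r n c ℓ} u .{{_ : NonZero u}} → r * u ≤ c * (ℓ * n) → k * c * ℓ ≤ u → k * r ≤ n
cancel-scale {k} {r} {n} {c} {ℓ} u ru≤ ≤u = *-cancelʳ-≤ (k * r) n u (begin
  k * r * u             ≡⟨ *-assoc k r u ⟩
  k * (r * u)           ≤⟨ *-monoʳ-≤ k ru≤ ⟩
  k * (c * (ℓ * n))     ≡⟨ regroup k c ℓ n ⟩
  n * (k * c * ℓ)       ≤⟨ *-monoʳ-≤ n ≤u ⟩
  n * u                 ∎)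
  where
  open ≤-Reasoning
  regroup : ∀ k c ℓ n → k * (c * (ℓ * n)) ≡ n * (k * c * ℓ)
  regroup = solve-∀

little-o : ∀ r c₀ c → (∀ n → let open Parameters n in c₀ * ℓ ≤ u → r n * u ≤ c * (ℓ * n)) → LittleO[n] r
-- The sum serves two purposes: c₀ makes the bound on r valid, and k c makes that bound small
-- enough.
little-o r c₀ c r≤ k with ℓ-u-growth (c₀ + k * c)
... | n₀ , growth = n₀ , λ n n≥n₀ → let open Parameters n in
  cancel-scale {k} {r n} {n} {c} {ℓ} u (r≤ n (≤-trans (*-monoˡ-≤ ℓ (m≤m+n c₀ (k * c))) (growth n n≥n₀)))
    (≤-trans (*-monoˡ-≤ ℓ (m≤n+m (k * c) c₀)) (growth n n≥n₀))

redundancy-little-o : LittleO[n] redundancy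
redundancy-little-o = little-o redundancy 12 (11 * 128 + 3) Redundancy.redundancy-≤

-- The data structure

ones-bit-≤ : ∀ {n} (S : Subset n) i → ones (bit S) i ≤ n
ones-bit-≤ S           zero    = z≤n
ones-bit-≤ []          (suc i) = ones-bit-≤ [] i
ones-bit-≤ (true ∷ S)  (suc i) = s≤s (ones-bit-≤ S i)
ones-bit-≤ (false ∷ S) (suc i) = m≤n⇒m≤1+n (ones-bit-≤ S i)

module _ {n} (S : Subset n) where

  open Parameters n
  open Rep (bit S)

  fits : Fits
  fits = Bounds.fits (bit S) (ones-bit-≤ S)

  ≤n⇒<2^w : ∀ {x} → x ≤ n → x < 2 ^ w
  ≤n⇒<2^w x≤n = ≤-<-trans x≤n (<-trans (n<1+n n) (Fits.1+n<2^w fits))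

  rank-evaluates : ∀ x μ → Stores μ representation → Evaluation._⇓_ w μ (toℕ x) rankExpr (rank x S)
  rank-evaluates x μ stored = subst (Evaluation._⇓_ w μ (toℕ x) rankExpr) (sym (rank≡ones x S))
    (Correctness.rank⇓ fits μ stored (toℕ x) (toℕ<n x))

  select-evaluates : ∀ i μ → Stores μ representation →
    Evaluation._⇓_ w μ (suc (toℕ i)) selectExpr (toℕ (select S i))
  select-evaluates i μ stored = Correctness.select⇓ fits μ stored (suc (toℕ i))
    (cong suc (sym (proj₂ (select-correct S i)))) (toℕ<n (select S i)) (proj₁ (select-correct S i))

  1+index≤n : ∀ (i : Fin (length (elements S))) → suc (toℕ i) ≤ n
  1+index≤n i with select-correct S i
  ... | member , count≡i = begin
    suc (toℕ i)                           ≡⟨ cong suc count≡i ⟨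
    suc (ones (bit S) y)                  ≡⟨ +-comm 1 _ ⟩
    ones (bit S) y + 1                    ≡⟨ cong (λ c → ones (bit S) y + [ c ]₁) member ⟨
    ones (bit S) y + [ bit S y ]₁         ≡⟨ sum<-suc _ y ⟨
    ones (bit S) (suc y)                  ≤⟨ ones-bit-≤ S (suc y) ⟩
    n                                     ∎
    where
    open ≤-Reasoning
    y = toℕ (select S i)

structure : (rankE selectE : Expr) → StaticStructure
structure rankE selectE = record
  { wordFactor    = wordsPerLog
  ; extraRegs     = registers
  ; encode        = λ {n} S → Parameters.Rep.representation n (bit S)
  ; rankProgram   = answer registers rankE
  ; selectProgram = answer registers selectE
  }
  where
  -- Besides register 0, the destination register 1 and `depth` many above it.
  registers = suc (depth rankE ⊔ depth selectE)

module _ (rankE selectE : Expr) where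

  rank-in-O[1] : (∀ {n} (S : Subset n) x μ → Stores μ (Parameters.Rep.representation n (bit S)) →
                  Evaluation._⇓_ (Parameters.w n) μ (toℕ x) rankE (rank x S)) →
                 AnswersRankInO[1] (structure rankE selectE)
  rank-in-O[1] correct = cost rankE + 1 , λ n S x →
    answer-correct {e = rankE} (≤n⇒<2^w S (<⇒≤ (toℕ<n x))) (s≤s (m≤m⊔n (depth rankE) (depth selectE))) (correct S x)

  select-in-O[1] : (∀ {n} (S : Subset n) i μ → Stores μ (Parameters.Rep.representation n (bit S)) →
                    Evaluation._⇓_ (Parameters.w n) μ (suc (toℕ i)) selectE (toℕ (select S i))) →
                   AnswersSelectInO[1] (structure rankE selectE)
  select-in-O[1] correct = cost selectE + 1 , λ n S i →
    answer-correct {e = selectE} (≤n⇒<2^w S (1+index≤n S i)) (s≤s (m≤n⊔m (depth rankE) (depth selectE))) (correct S i)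

mainTheorem1 : Σ[ E ∈ StaticStructure ]
    ( UsesSpace[nH₀+o[n]] E
    × AnswersRankInO[1] E
    × AnswersSelectInO[1] E )
mainTheorem1 = structure rankExpr selectExpr
  , (redundancy , redundancy-little-o , space)
  , rank-in-O[1] rankExpr selectExpr rank-evaluates
  , select-in-O[1] rankExpr selectExpr select-evaluates
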